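{- Let $I^3_4$ be the 3-graph on 4 vertices with no edges, and let $M_2$ be the 3-graph on the six vertices $\mathbb Z_3\times\{1,2\}$ obtained as follows: let $\Gamma$ be the oriented graph on $\mathbb Z_3\times\{1,2\}$ with an edge from $(a,x)$ to $(b,y)$ iff ($x+y<0$ and $b=a+1$) or ($x+y>0$ and $b=a-1$), and let a triple $\{u,v,w\}$ be an edge of $M_2$ iff the oriented graph induced by $\Gamma$ on $\{u,v,w\}$ contains a vertex of in-degree and out-degree $0$ within the triple, or a vertex of out-degree $2$ within the triple. Then $\pi_{\min}(I^3_4,M_2)\ge 0.4557$.
   Context: A 3-graph is a 3-uniform hypergraph. For a finite family $\mathcal H$ of 3-graphs and an integer $n$, $\mathrm{ex}_{\min}(n;\mathcal H)$ denotes the minimal possible number of edges in an $n$-vertex 3-graph containing no member of $\mathcal H$ as an induced subgraph, and $\pi_{\min}(\mathcal H)=\lim_{n\to\infty}\mathrm{ex}_{\min}(n;\mathcal H)/\binom n3$ (this limit exists). The 3-graph $M_2$ is the unique $I^3_4$-free 3-graph with six vertices and six edges. -}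

module Defs where

open import Data.Nat using (ℕ; zero; suc; _≤_; _%_; _<ᵇ_)
open import Data.Nat.Combinatorics using (_C_)
open import Data.Integer as ℤ using (ℤ; +_)
open import Data.Rational as ℚ using (ℚ; 0ℚ; _/_)
open import Data.Fin using (Fin; toℕ; _<?_)
open import Data.Bool using (Bool; true; false; _∧_; _∨_; not; if_then_else_)
open import Data.List using (List; []; _∷_; map; allFin)
open import Data.Nat.ListAction using (sum)
open import Data.List.Relation.Unary.All using (All)
open import Data.Product using (Σ; _×_; ∃-syntax)
open import Relation.Nullary using (¬_; ⌊_⌋)
open import Relation.Binary.PropositionalEquality using (_≡_; _≢_; refl; cong₂)
open import Function.Definitions using (Injective)

-- 3-graphs (3-uniform hypergraphs) on the vertex set Fin n.
-- The edge indicator is a Bool-valued function on ordered triples which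
-- is invariant under permuting its arguments; only its values on
-- triples of distinct vertices are meaningful.

record 3Graph (n : ℕ) : Set where
  field
    edge : Fin n → Fin n → Fin n → Bool
    sym₁ : ∀ a b c → edge a b c ≡ edge b a c
    sym₂ : ∀ a b c → edge a b c ≡ edge a c b
open 3Graph public

b2n : Bool → ℕ
b2n true = 1
b2n false = 0

numEdges : ∀ {n} → 3Graph n → ℕ
numEdges {n} G =
  sum (map (λ a → sum (map (λ b → sum (map (λ c →
    b2n (⌊ a <? b ⌋ ∧ ⌊ b <? c ⌋ ∧ edge G a b c))
    (allFin n))) (allFin n))) (allFin n))

InducedCopy : ∀ {m n} → 3Graph m → 3Graph n → Set
InducedCopy {m} {n} F G =
  Σ (Fin m → Fin n) λ f → Injective _≡_ _≡_ f ×
    (∀ a b c → a ≢ b → b ≢ c → a ≢ c → edge F a b c ≡ edge G (f a) (f b) (f c))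

Forb : Set
Forb = Σ ℕ 3Graph

Free : List Forb → ∀ {n} → 3Graph n → Set
Free ℋ G = All (λ F → ¬ InducedCopy (Data.Product.proj₂ F) G) ℋ

ℕtoℚ : ℕ → ℚ
ℕtoℚ k = + k / 1

-- π_min(ℋ) ≥ c.  Since π_min(ℋ) = lim ex_min(n;ℋ)/C(n,3) exists, this is
-- equivalent to: for every ε > 0, for all large n, ex_min(n;ℋ) ≥ (c-ε)C(n,3),
-- i.e. every ℋ-free 3-graph on n vertices has at least (c-ε)C(n,3) edges.
πmin≥ : List Forb → ℚ → Set
πmin≥ ℋ c = ∀ (ε : ℚ) → ε ℚ.> 0ℚ → ∃[ N ] ∀ n → N ≤ n → (G : 3Graph n) → Free ℋ G →
  (c ℚ.- ε) ℚ.* ℕtoℚ (n C 3) ℚ.≤ ℕtoℚ (numEdges G)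

I34 : 3Graph 4
I34 = record { edge = λ _ _ _ → false ; sym₁ = λ _ _ _ → refl ; sym₂ = λ _ _ _ → refl }

-- M_2 on Z_3 × {1,2}.  Vertex i : Fin 6 encodes (toℕ i mod 3 , 1) for
-- i < 3 and (toℕ i mod 3 , 2) for i ≥ 3.

layer : Fin 6 → ℕ
layer i = toℕ i % 3

side : Fin 6 → ℤ
side i = if toℕ i <ᵇ 3 then + 1 else + 2

Γ : Fin 6 → Fin 6 → Bool
Γ u v =
  (⌊ (side u ℤ.+ side v) ℤ.<? + 0 ⌋ ∧ ⌊ layer v Data.Nat.≟ ((layer u Data.Nat.+ 1) % 3) ⌋)
  ∨ (⌊ + 0 ℤ.<? (side u ℤ.+ side v) ⌋ ∧ ⌊ layer v Data.Nat.≟ ((layer u Data.Nat.+ 2) % 3) ⌋)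

-- given the arcs between u and its two partners v,w in the triple:
-- u has in- and out-degree 0, or u has out-degree 2
vertexCond : (uv vu uw wu : Bool) → Bool
vertexCond uv vu uw wu = not (uv ∨ vu ∨ uw ∨ wu) ∨ (uv ∧ uw)

P : Fin 6 → Fin 6 → Fin 6 → Bool
P u v w = vertexCond (Γ u v) (Γ v u) (Γ u w) (Γ w u)

M2edge : Fin 6 → Fin 6 → Fin 6 → Bool
M2edge u v w = P u v w ∨ P v u w ∨ P w u v

private
  vc-swap : ∀ a b c d → vertexCond a b c d ≡ vertexCond c d a b
  vc-swap false false false false = refl
  vc-swap false false false true = refl
  vc-swap false false true false = refl
  vc-swap false false true true = refl
  vc-swap false true false false = refl
  vc-swap false true false true = refl
  vc-swap false true true false = refl
  vc-swap false true true true = refl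
  vc-swap true false false false = refl
  vc-swap true false false true = refl
  vc-swap true false true false = refl
  vc-swap true false true true = refl
  vc-swap true true false false = refl
  vc-swap true true false true = refl
  vc-swap true true true false = refl
  vc-swap true true true true = refl

  P-swap : ∀ u v w → P u v w ≡ P u w v
  P-swap u v w = vc-swap (Γ u v) (Γ v u) (Γ u w) (Γ w u)

  or12 : ∀ x y z → x ∨ y ∨ z ≡ y ∨ x ∨ z
  or12 false y z = refl
  or12 true false z = refl
  or12 true true z = refl

  or23 : ∀ x y z → x ∨ y ∨ z ≡ x ∨ z ∨ y
  or23 false false false = refl
  or23 false false true = refl
  or23 false true false = refl
  or23 false true true = refl
  or23 true y z = refl

  M2-sym₁ : ∀ a b c → M2edge a b c ≡ M2edge b a c
  M2-sym₁ a b c rewrite P-swap c b a = or12 (P a b c) (P b a c) (P c a b)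

  M2-sym₂ : ∀ a b c → M2edge a b c ≡ M2edge a c b
  M2-sym₂ a b c rewrite P-swap a c b = or23 (P a b c) (P b a c) (P c a b)

M2 : 3Graph 6
M2 = record { edge = M2edge ; sym₁ = M2-sym₁ ; sym₂ = M2-sym₂ }

module Submission where

-- Idea: a flag algebra certificate on six vertices.  For an ordered 4-tuple that induces one of four
-- labelled patterns, every further vertex carries an integer vector; the inner products ⟨u_x , u_y⟩
-- sum to a square over all x and y.  Two more vertices on an ordered pair are treated in the same way.
-- The weight of a 6-tuple is 10⁸ ([first three span an edge] - 0.4557) minus such inner products, so
-- its total is at most 10⁸ n³ (6 e(G) - 0.4557 n³) + O(n⁵).  On the other hand, its average over the
-- orderings of six distinct vertices is nonnegative unless they contain I₄ or span M₂, a finite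
-- statement, and only O(n⁵) tuples are not injective.  The average is invariant under S₆, so that the
-- finite statement is needed only when no transposition of adjacent vertices lexicographically lowers
-- the pattern on the first five; this leaves 35 patterns on five vertices with their extensions.
-- The vectors round a solution of a semidefinite program whose optimal value is about 0.45577.

open import Defs
open import Data.Bool using (Bool; true; false; _∧_; _∨_; not; if_then_else_; T)
open import Data.Bool.ListAction using (any)
open import Data.Bool.Properties using (T-≡)
open import Data.Fin as Fin using (Fin; zero; suc; toℕ; inject₁; punchIn; _↑ˡ_; _<?_; _≟_; #_)
open import Data.Fin.Patterns using (0F; 1F; 2F; 3F; 4F; 5F)
open import Data.Fin.Properties as FinP using (toℕ-injective; toℕ<n; ↑ˡ-injective)
open import Data.Integer as ℤ using (ℤ; +_; -[1+_]; _+_; _-_; _*_; _^_; _⊖_; -_; _≤_; +≤+; -≤+; 0ℤ)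
open import Data.Integer.Properties as ℤP using (≤-refl; ≤-reflexive; ≤-trans; +-mono-≤; +-*-semiring)
open import Data.Integer.Tactic.RingSolver using (solve-∀)
open import Data.List as List using (List; []; _∷_; allFin; concatMap; foldr; length; map)
open import Data.List.Properties using (map-++; map-∘; map-concatMap; map-cong; map-tabulate)
open import Data.List.Relation.Unary.All using ([]; _∷_)
open import Data.Maybe as Maybe using (Maybe; just; nothing)
open import Data.Nat as ℕ using (ℕ; zero; suc; _<ᵇ_; _≡ᵇ_)
open import Data.Nat.Combinatorics using (_C_; nCk+nC[k+1]≡[n+1]C[k+1]; nC1≡n)
open import Data.Nat.Coprimality using (Coprime)
open import Data.Nat.DivMod using ([m+kn]%n≡m%n; m<n⇒m%n≡m)
open import Data.Nat.Induction using (<-wellFounded)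
open import Data.Nat.ListAction using () renaming (sum to sumℕ)
import Data.Nat.Properties as ℕP
import Data.Nat.Tactic.RingSolver as ℕ-Solver
open import Data.Product using (Σ; _×_; _,_; proj₁; proj₂; ∃-syntax)
open import Data.Rational as ℚ using (ℚ; mkℚ; toℚᵘ; *<*; _/_)
import Data.Rational.Properties as ℚP
open import Data.Rational.Unnormalised as ℚᵘ using (mkℚᵘ; *≤*)
import Data.Rational.Unnormalised.Properties as ℚᵘP
open import Data.Sum using (_⊎_; inj₁; inj₂)
open import Data.Unit using (tt)
open import Data.Vec as Vec using (Vec; []; _∷_; _++_)
open import Data.Vec.Properties using (map-lookup-allFin)
open import Function using (_∘_; id)
open import Function.Bundles using (Equivalence)
open import Function.Definitions using (Injective)
open import Induction.WellFounded using (Acc; acc)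
open import Relation.Binary using (tri<; tri≈; tri>)
open import Relation.Binary.PropositionalEquality
  using (_≡_; _≢_; refl; sym; trans; cong; cong₂; subst; subst₂; _≗_; module ≡-Reasoning)
open import Relation.Nullary using (¬_; yes; no; ⌊_⌋; contradiction)
open import Algebra.Properties.CommutativeSemigroup ℕP.+-commutativeSemigroup
  using () renaming (interchange to ℕ-interchange; x∙yz≈y∙xz to ℕ-leftSwap)
open import Algebra.Properties.CommutativeSemigroup ℤP.+-commutativeSemigroup
  using () renaming (x∙yz≈y∙xz to ℤ-leftSwap)
open import Algebra.Properties.Semiring.Sum +-*-semiring
  using (sum; sum-cong-≗; ∑-distrib-+; ∑-comm; *-distribˡ-sum)

-- The obstacle is the size of the finite statement: 2²⁰ patterns with 720 orderings each, settled
-- by evaluation. The weight reads no triple that contains both x and y, and the 48 orderings that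
-- keep the split into abcd and xy permute these four triples among themselves. The sum over the 48
-- orderings is thus a function of the other sixteen bits and can be tabulated, in stages with 4, 3,
-- 2 and 2 terms; a pattern then costs fifteen lookups, one for each choice of xy. Positivity holds
-- by construction: the semidefinite matrices are given as Gram matrices, and any integer vectors
-- yield squares. Rounding can only harm the inequalities between coefficients, and the gap between
-- 0.4557 and the optimum absorbs it. Vectors with four decimals have inner products in units of
-- 10⁻⁸, whence the factor 10⁸. Four patterns on abcd suffice, since a 3-graph on four vertices is
-- determined up to isomorphism by its number of edges, and zero edges are excluded.

private variable
  A A₁ A₂ : Set
  n k m : ℕ

-- Bit patterns of six vertices and the action of adjacent transpositions

-- The bits of the twenty triples of six vertices a b c d x y: s for those inside abcd, x and y for those
-- that add x or y to a pair from abcd, z for those that contain both x and y.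
data Pattern : Set where
  pattern₆ : (s₀ s₁ s₂ s₃ x₀ x₁ x₂ x₃ x₄ x₅ y₀ y₁ y₂ y₃ y₄ y₅ z₀ z₁ z₂ z₃ : Bool) → Pattern

data Key : Set where
  key : (s₀ s₁ s₂ s₃ x₀ x₁ x₂ x₃ x₄ x₅ y₀ y₁ y₂ y₃ y₄ y₅ : Bool) → Key

toKey : Pattern → Key
toKey (pattern₆ s₀ s₁ s₂ s₃ x₀ x₁ x₂ x₃ x₄ x₅ y₀ y₁ y₂ y₃ y₄ y₅ z₀ z₁ z₂ z₃)
  = key s₀ s₁ s₂ s₃ x₀ x₁ x₂ x₃ x₄ x₅ y₀ y₁ y₂ y₃ y₄ y₅

toVec : Key → Vec Bool 16
toVec (key s₀ s₁ s₂ s₃ x₀ x₁ x₂ x₃ x₄ x₅ y₀ y₁ y₂ y₃ y₄ y₅)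
  = s₀ ∷ s₁ ∷ s₂ ∷ s₃ ∷ x₀ ∷ x₁ ∷ x₂ ∷ x₃ ∷ x₄ ∷ x₅ ∷ y₀ ∷ y₁ ∷ y₂ ∷ y₃ ∷ y₄ ∷ y₅ ∷ []

fromVec : Vec Bool 16 → Key
fromVec (s₀ ∷ s₁ ∷ s₂ ∷ s₃ ∷ x₀ ∷ x₁ ∷ x₂ ∷ x₃ ∷ x₄ ∷ x₅ ∷ y₀ ∷ y₁ ∷ y₂ ∷ y₃ ∷ y₄ ∷ y₅ ∷ [])
  = key s₀ s₁ s₂ s₃ x₀ x₁ x₂ x₃ x₄ x₅ y₀ y₁ y₂ y₃ y₄ y₅

flatten : Pattern → Vec Bool 20
flatten (pattern₆ s₀ s₁ s₂ s₃ x₀ x₁ x₂ x₃ x₄ x₅ y₀ y₁ y₂ y₃ y₄ y₅ z₀ z₁ z₂ z₃)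
  = s₀ ∷ s₁ ∷ s₂ ∷ s₃ ∷ x₀ ∷ x₁ ∷ x₂ ∷ x₃ ∷ x₄ ∷ x₅ ∷ y₀ ∷ y₁ ∷ y₂ ∷ y₃ ∷ y₄ ∷ y₅ ∷ z₀ ∷ z₁ ∷ z₂ ∷ z₃ ∷ []

toPattern : Vec Bool 20 → Pattern
toPattern (s₀ ∷ s₁ ∷ s₂ ∷ s₃ ∷ x₀ ∷ x₁ ∷ x₂ ∷ x₃ ∷ x₄ ∷ x₅ ∷ y₀ ∷ y₁ ∷ y₂ ∷ y₃ ∷ y₄ ∷ y₅ ∷ z₀ ∷ z₁ ∷ z₂ ∷ z₃ ∷ [])
  = pattern₆ s₀ s₁ s₂ s₃ x₀ x₁ x₂ x₃ x₄ x₅ y₀ y₁ y₂ y₃ y₄ y₅ z₀ z₁ z₂ z₃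

swapAt : ∀ {n} → Fin n → Vec A (suc n) → Vec A (suc n)
swapAt zero    (a ∷ b ∷ v) = b ∷ a ∷ v
swapAt (suc i) (a ∷ v)     = a ∷ swapAt i v

bits : (A → A → A → Bool) → Vec A 6 → Pattern
bits e (a ∷ b ∷ c ∷ d ∷ x ∷ y ∷ []) = pattern₆
  (e a b c) (e a b d) (e a c d) (e b c d)
  (e a b x) (e a c x) (e a d x) (e b c x) (e b d x) (e c d x)
  (e a b y) (e a c y) (e a d y) (e b c y) (e b d y) (e c d y)
  (e a x y) (e b x y) (e c x y) (e d x y)

-- The permutation of the twenty triples induced by exchanging two neighbouring vertices;
-- `bits-swap` ties it to the action on vertices.
swapBits : Fin 5 → Pattern → Pattern
swapBits 0F (pattern₆ s₀ s₁ s₂ s₃ x₀ x₁ x₂ x₃ x₄ x₅ y₀ y₁ y₂ y₃ y₄ y₅ z₀ z₁ z₂ z₃)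
  = pattern₆ s₀ s₁ s₃ s₂ x₀ x₃ x₄ x₁ x₂ x₅ y₀ y₃ y₄ y₁ y₂ y₅ z₁ z₀ z₂ z₃
swapBits 1F (pattern₆ s₀ s₁ s₂ s₃ x₀ x₁ x₂ x₃ x₄ x₅ y₀ y₁ y₂ y₃ y₄ y₅ z₀ z₁ z₂ z₃)
  = pattern₆ s₀ s₂ s₁ s₃ x₁ x₀ x₂ x₃ x₅ x₄ y₁ y₀ y₂ y₃ y₅ y₄ z₀ z₂ z₁ z₃
swapBits 2F (pattern₆ s₀ s₁ s₂ s₃ x₀ x₁ x₂ x₃ x₄ x₅ y₀ y₁ y₂ y₃ y₄ y₅ z₀ z₁ z₂ z₃)
  = pattern₆ s₁ s₀ s₂ s₃ x₀ x₂ x₁ x₄ x₃ x₅ y₀ y₂ y₁ y₄ y₃ y₅ z₀ z₁ z₃ z₂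
swapBits 3F (pattern₆ s₀ s₁ s₂ s₃ x₀ x₁ x₂ x₃ x₄ x₅ y₀ y₁ y₂ y₃ y₄ y₅ z₀ z₁ z₂ z₃)
  = pattern₆ s₀ x₀ x₁ x₃ s₁ s₂ x₂ s₃ x₄ x₅ y₀ y₁ z₀ y₃ z₁ z₂ y₂ y₄ y₅ z₃
swapBits 4F (pattern₆ s₀ s₁ s₂ s₃ x₀ x₁ x₂ x₃ x₄ x₅ y₀ y₁ y₂ y₃ y₄ y₅ z₀ z₁ z₂ z₃)
  = pattern₆ s₀ s₁ s₂ s₃ y₀ y₁ y₂ y₃ y₄ y₅ x₀ x₁ x₂ x₃ x₄ x₅ z₀ z₁ z₂ z₃

-- Swapping d and x does not act on keys, so 3F stands for the swap of x and y here.
swapKey : Fin 4 → Key → Key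
swapKey 0F (key s₀ s₁ s₂ s₃ x₀ x₁ x₂ x₃ x₄ x₅ y₀ y₁ y₂ y₃ y₄ y₅)
  = key s₀ s₁ s₃ s₂ x₀ x₃ x₄ x₁ x₂ x₅ y₀ y₃ y₄ y₁ y₂ y₅
swapKey 1F (key s₀ s₁ s₂ s₃ x₀ x₁ x₂ x₃ x₄ x₅ y₀ y₁ y₂ y₃ y₄ y₅)
  = key s₀ s₂ s₁ s₃ x₁ x₀ x₂ x₃ x₅ x₄ y₁ y₀ y₂ y₃ y₅ y₄
swapKey 2F (key s₀ s₁ s₂ s₃ x₀ x₁ x₂ x₃ x₄ x₅ y₀ y₁ y₂ y₃ y₄ y₅)
  = key s₁ s₀ s₂ s₃ x₀ x₂ x₁ x₄ x₃ x₅ y₀ y₂ y₁ y₄ y₃ y₅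
swapKey 3F (key s₀ s₁ s₂ s₃ x₀ x₁ x₂ x₃ x₄ x₅ y₀ y₁ y₂ y₃ y₄ y₅)
  = key s₀ s₁ s₂ s₃ y₀ y₁ y₂ y₃ y₄ y₅ x₀ x₁ x₂ x₃ x₄ x₅

act : (A → A₁ → A₁) → List A → A₁ → A₁
act _·_ []      p = p
act _·_ (g ∷ w) p = act _·_ w (g · p)

-- A list of words is read as one walk: each word continues from where the previous one ended.
visits : (A → A₁ → A₁) → List (List A) → A₁ → List A₁
visitsFrom : (A → A₁ → A₁) → List (List A) → A₁ → List A₁
visits _·_ []      p = []
visits _·_ (w ∷ π) p = visitsFrom _·_ π (act _·_ w p)
visitsFrom _·_ π p = p ∷ visits _·_ π p

sumℤ : List ℤ → ℤ
sumℤ = foldr _+_ (+ 0)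

orbitSum : (A → A₁ → A₁) → List (List A) → (A₁ → ℤ) → A₁ → ℤ
orbitSum _·_ π f p = sumℤ (map f (visits _·_ π p))

-- Tabulated functions of bit vectors

data Trie (A : Set) : ℕ → Set where
  leaf : A → Trie A zero
  node : Trie A n → Trie A n → Trie A (suc n)

tabulate : ∀ n → (Vec Bool n → A) → Trie A n
tabulate zero    f = leaf (f [])
tabulate (suc n) f = node (tabulate n (f ∘ (false ∷_))) (tabulate n (f ∘ (true ∷_)))

lookupT : Trie A n → Vec Bool n → A
lookupT (leaf a)   []          = a
lookupT (node s t) (false ∷ v) = lookupT s v
lookupT (node s t) (true ∷ v)  = lookupT t v

-- Evaluation is call-by-need, so a trie serves as a table that is filled in on demand.
memo : (Key → ℤ) → Trie ℤ 16
memo f = tabulate 16 (f ∘ fromVec)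

recall : Trie ℤ 16 → Key → ℤ
recall t k = lookupT t (toVec k)

stages : List (List (List (Fin 4))) → Trie ℤ 16 → Trie ℤ 16
stages []       t = t
stages (π ∷ πs) t = stages πs (memo (orbitSum swapKey π (recall t)))

-- The weight and its vectors

-- Lists count as padded by zeros up to the given number of coordinates, so that `gram-nonneg` holds
-- for vectors of any lengths.
dot : ℕ → List ℤ → List ℤ → ℤ
dot zero    _        _        = + 0
dot (suc m) []       _        = + 0
dot (suc m) (x ∷ xs) []       = + 0
dot (suc m) (x ∷ xs) (y ∷ ys) = x * y + dot m xs ys

-- `t₀` is indexed by the four triples of two labels and two further vertices, the other tables by
-- the six triples that one further vertex forms with pairs of four labels.
record Tables : Set where
  constructor tables
  field
    t₀          : Trie (List ℤ) 4
    t₁ t₂ t₃ t₄ : Trie (List ℤ) 6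

-- One labelled representative for each number of edges from 1 to 4. Other labellings get the zero
-- vector; the sum over all orderings still brings every nonempty abcd to its representative.
gram₄ : Tables → Vec Bool 4 → Vec Bool 6 → List ℤ
gram₄ T (true  ∷ false ∷ false ∷ false ∷ []) x = lookupT (Tables.t₁ T) x
gram₄ T (true  ∷ true  ∷ false ∷ false ∷ []) x = lookupT (Tables.t₂ T) x
gram₄ T (false ∷ true  ∷ true  ∷ true  ∷ []) x = lookupT (Tables.t₃ T) x
gram₄ T (true  ∷ true  ∷ true  ∷ true  ∷ []) x = lookupT (Tables.t₄ T) x
gram₄ T _ x = []

weight : Tables → Key → ℤ
weight T (key s₀ s₁ s₂ s₃ x₀ x₁ x₂ x₃ x₄ x₅ y₀ y₁ y₂ y₃ y₄ y₅) =
  -- These are 10⁸ (1 - 0.4557) and -10⁸ · 0.4557.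
  (if s₀ then + 54430000 else -[1+ 45569999 ])
  -- 14 is the largest of the four vector lengths 4, 14, 9 and 12.
  - dot 14 (gram₄ T s (x₀ ∷ x₁ ∷ x₂ ∷ x₃ ∷ x₄ ∷ x₅ ∷ [])) (gram₄ T s (y₀ ∷ y₁ ∷ y₂ ∷ y₃ ∷ y₄ ∷ y₅ ∷ []))
  -- The pairs added to the labels ab are cx and dy, so again no triple contains both x and y.
  - dot 3 (lookupT (Tables.t₀ T) (s₀ ∷ x₀ ∷ x₁ ∷ x₃ ∷ [])) (lookupT (Tables.t₀ T) (s₁ ∷ y₀ ∷ y₂ ∷ y₄ ∷ []))
  where
  s : Vec Bool 4
  s = s₀ ∷ s₁ ∷ s₂ ∷ s₃ ∷ []

nth : List ℕ → ℕ → ℕ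
nth []       _       = 0
nth (x ∷ xs) zero    = x
nth (x ∷ xs) (suc i) = nth xs i

value : ℕ → Vec Bool n → ℕ
value a []          = a
value a (false ∷ v) = value (2 ℕ.* a) v
value a (true ∷ v)  = value (1 ℕ.+ 2 ℕ.* a) v

-- Digits from 50000 on encode negative coordinates, which lets one natural number carry a signed
-- vector.
balanced : ℕ → ℤ
balanced d = if d <ᵇ 50000 then + d else d ⊖ 100000

digits : ℕ → ℕ → List ℤ
digits zero    _ = []
digits (suc r) N = balanced (N ℕ.% 100000) ∷ digits r (N ℕ./ 100000)

-- Row i belongs to the bits that form the binary numeral i, and its entries are base-10⁵ digits.
unpack : ∀ n → ℕ → List ℕ → Trie (List ℤ) n
unpack n r rows = tabulate n (λ v → digits r (nth rows (value 0 v)))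

-- Walks through the orderings and the finite check

-- Each walk carries one vertex forward through all places before it, as in insertion sort.
-- Composed, they give every ordering that keeps the split into abcd and xy once.
pathS₂ pathS₃ pathS₄ pathXY : List (List (Fin 4))
pathS₂ = [] ∷ (0F ∷ []) ∷ []
pathS₃ = [] ∷ (1F ∷ []) ∷ (0F ∷ []) ∷ []
pathS₄ = [] ∷ (2F ∷ []) ∷ (1F ∷ []) ∷ (0F ∷ []) ∷ []
pathXY = [] ∷ (3F ∷ []) ∷ []

innerPaths : List (List (List (Fin 4)))
innerPaths = pathS₄ ∷ pathS₃ ∷ pathS₂ ∷ pathXY ∷ []

-- The walk meets every way to split six vertices into abcd and xy once.
outerPath : List (List (Fin 5))
outerPath = [] ∷ (3F ∷ []) ∷ (4F ∷ 3F ∷ []) ∷ (2F ∷ 3F ∷ []) ∷ (4F ∷ 3F ∷ []) ∷ (2F ∷ 3F ∷ [])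
  ∷ (1F ∷ 2F ∷ 3F ∷ []) ∷ (4F ∷ 3F ∷ []) ∷ (2F ∷ 3F ∷ []) ∷ (1F ∷ 2F ∷ 3F ∷ [])
  ∷ (0F ∷ 1F ∷ 2F ∷ 3F ∷ []) ∷ (4F ∷ 3F ∷ []) ∷ (2F ∷ 3F ∷ []) ∷ (1F ∷ 2F ∷ 3F ∷ [])
  ∷ (0F ∷ 1F ∷ 2F ∷ 3F ∷ []) ∷ []

-- Only the ten triples of the first five vertices enter. Swaps `0F` to `3F` permute these, so their
-- descents can be tested on a prefix; a descent at `4F` compares abcdx with abcdy.
code : Pattern → ℕ
code (pattern₆ s₀ s₁ s₂ s₃ x₀ x₁ x₂ x₃ x₄ x₅ y₀ y₁ y₂ y₃ y₄ y₅ z₀ z₁ z₂ z₃) =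
  value 0 (s₀ ∷ s₁ ∷ s₂ ∷ s₃ ∷ x₀ ∷ x₁ ∷ x₂ ∷ x₃ ∷ x₄ ∷ x₅ ∷ [])

descends : Fin 5 → Pattern → Bool
descends i p = code (swapBits i p) <ᵇ code p

empty₄ : Pattern → Bool
empty₄ (pattern₆ false false false false x₀ x₁ x₂ x₃ x₄ x₅ y₀ y₁ y₂ y₃ y₄ y₅ z₀ z₁ z₂ z₃) = true
empty₄ _ = false

_==_ : Bool → Bool → Bool
true  == b = b
false == b = not b

_≈ᵇ_ : Vec Bool n → Vec Bool n → Bool
[]      ≈ᵇ []      = true
(a ∷ u) ≈ᵇ (b ∷ v) = (a == b) ∧ (u ≈ᵇ v)

nonNegative : ℤ → Bool
nonNegative (+ _)    = true
nonNegative -[1+ _ ] = false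

M₂-pattern : Pattern
M₂-pattern = bits M2edge (0F ∷ 1F ∷ 2F ∷ 3F ∷ 4F ∷ 5F ∷ [])

-- These words carry the three copies of M₂ that survive the reduction to M₂-pattern.
M₂-words : List (List (Fin 5))
M₂-words = (0F ∷ 2F ∷ 1F ∷ [])
  ∷ (1F ∷ 3F ∷ [])
  ∷ (1F ∷ 0F ∷ 2F ∷ 3F ∷ 2F ∷ []) ∷ []

isM₂ : List (List (Fin 5)) → Pattern → Bool
isM₂ ws p = any (λ w → flatten (act swapBits w p) ≈ᵇ flatten M₂-pattern) ws

-- Along `outerPath` each set of four vertices becomes abcd once, so testing the first four vertices
-- tests all such sets.
hasI₄ : List (List (Fin 5)) → Pattern → Bool
hasI₄ π p = any empty₄ (visits swapBits π p)

averageOk : List (List (Fin 5)) → Trie ℤ 16 → Pattern → Bool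
averageOk π t p = nonNegative (orbitSum swapBits π (recall t ∘ toKey) p)

allVec : ∀ n → (Vec Bool n → Bool) → Bool
allVec zero    f = f []
allVec (suc n) f = allVec n (f ∘ (false ∷_)) ∧ allVec n (f ∘ (true ∷_))

prefixOut : Pattern → Bool
prefixOut p = empty₄ p ∨ descends 0F p ∨ descends 1F p ∨ descends 2F p ∨ descends 3F p

extOk : List (List (Fin 5)) → List (List (Fin 5)) → Trie ℤ 16 → Pattern → Bool
extOk ws π t p = descends 4F p ∨ hasI₄ π p ∨ averageOk π t p ∨ isM₂ ws p

-- The guard comes before the inner quantifier, so that the 2ⁿ extensions are examined only for
-- prefixes that survive it.
guardedAll : ∀ m n → (Vec Bool m → Bool) → (Vec Bool m → Vec Bool n → Bool) → Bool
guardedAll m n f g = allVec m (λ v → f v ∨ allVec n (g v))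

-- The padding stands for any extension: by `prefixOut-cong` all of them give the same answer.
prefixCheck : Vec Bool 10 → Bool
prefixCheck v = prefixOut (toPattern (v ++ Vec.replicate 10 false))

extCheck : List (List (Fin 5)) → List (List (Fin 5)) → Trie ℤ 16 → Vec Bool 10 → Vec Bool 10 → Bool
extCheck ws π t v v′ = extOk ws π t (toPattern (v ++ v′))

-- Sums over tuples of vertices

sum-mono : {f g : Fin n → ℤ} → (∀ i → f i ≤ g i) → sum f ≤ sum g
sum-mono {zero}  f≤g = ≤-refl
sum-mono {suc n} f≤g = +-mono-≤ (f≤g zero) (sum-mono (f≤g ∘ suc))

sum-const : ∀ n (c : ℤ) → sum {n} (λ _ → c) ≡ + n * c
sum-const zero    c = sym (ℤP.*-zeroˡ c)
sum-const (suc n) c = trans (cong₂ _+_ (refl {x = c}) (sum-const n c)) (sym (ℤP.suc-* (+ n) c))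

∑ⱽ : ∀ k → (Vec (Fin n) k → ℤ) → ℤ
∑ⱽ zero    f = f []
∑ⱽ (suc k) f = sum λ i → ∑ⱽ k (f ∘ (i ∷_))

∑ⱽ-cong : ∀ k {f g : Vec (Fin n) k → ℤ} → f ≗ g → ∑ⱽ k f ≡ ∑ⱽ k g
∑ⱽ-cong zero    f≗g = f≗g []
∑ⱽ-cong (suc k) f≗g = sum-cong-≗ λ i → ∑ⱽ-cong k (f≗g ∘ (i ∷_))

∑ⱽ-mono : ∀ k {f g : Vec (Fin n) k → ℤ} → (∀ v → f v ≤ g v) → ∑ⱽ k f ≤ ∑ⱽ k g
∑ⱽ-mono zero    f≤g = f≤g []
∑ⱽ-mono (suc k) f≤g = sum-mono λ i → ∑ⱽ-mono k (f≤g ∘ (i ∷_))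

∑ⱽ-+ : ∀ k (f g : Vec (Fin n) k → ℤ) → ∑ⱽ k (λ v → f v + g v) ≡ ∑ⱽ k f + ∑ⱽ k g
∑ⱽ-+ zero    f g = refl
∑ⱽ-+ (suc k) f g = trans (sum-cong-≗ λ i → ∑ⱽ-+ k (f ∘ (i ∷_)) (g ∘ (i ∷_)))
                         (∑-distrib-+ (λ i → ∑ⱽ k (f ∘ (i ∷_))) (λ i → ∑ⱽ k (g ∘ (i ∷_))))

∑ⱽ-* : ∀ k (c : ℤ) (f : Vec (Fin n) k → ℤ) → ∑ⱽ k (λ v → c * f v) ≡ c * ∑ⱽ k f
∑ⱽ-* zero    c f = refl
∑ⱽ-* (suc k) c f = trans (sum-cong-≗ λ i → ∑ⱽ-* k c (f ∘ (i ∷_)))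
                         (sym (*-distribˡ-sum c (λ i → ∑ⱽ k (f ∘ (i ∷_)))))

∑ⱽ-const : ∀ n k (c : ℤ) → ∑ⱽ {n} k (λ _ → c) ≡ (+ n) ^ k * c
∑ⱽ-const n zero    c = sym (ℤP.*-identityˡ c)
∑ⱽ-const n (suc k) c = begin
  sum {n} (λ _ → ∑ⱽ k (λ _ → c)) ≡⟨ sum-cong-≗ {n} (λ _ → ∑ⱽ-const n k c) ⟩
  sum {n} (λ _ → (+ n) ^ k * c)     ≡⟨ sum-const n _ ⟩
  + n * ((+ n) ^ k * c)           ≡⟨ ℤP.*-assoc (+ n) ((+ n) ^ k) c ⟨
  (+ n) ^ suc k * c                 ∎
  where open ≡-Reasoning

∑ⱽ-sum : ∀ k {m} (f : Fin m → Vec (Fin n) k → ℤ) → ∑ⱽ k (λ v → sum λ i → f i v) ≡ sum λ i → ∑ⱽ k (f i)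
∑ⱽ-sum zero    f = refl
∑ⱽ-sum (suc k) f = trans (sum-cong-≗ λ j → ∑ⱽ-sum k (λ i → f i ∘ (j ∷_)))
                         (∑-comm (λ j i → ∑ⱽ k (f i ∘ (j ∷_))))

-- Swapping adjacent places exchanges two neighbouring summations.
∑ⱽ-swapAt : ∀ (i : Fin k) (f : Vec (Fin n) (suc k) → ℤ) → ∑ⱽ (suc k) (f ∘ swapAt i) ≡ ∑ⱽ (suc k) f
∑ⱽ-swapAt {suc k} zero    f = ∑-comm (λ a b → ∑ⱽ k (λ v → f (b ∷ a ∷ v)))
∑ⱽ-swapAt         (suc i) f = sum-cong-≗ λ a → ∑ⱽ-swapAt i (f ∘ (a ∷_))

module _ {A : Set} (_·_ : A → Vec (Fin n) k → Vec (Fin n) k)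
         (invariant : ∀ a f → ∑ⱽ k (f ∘ (a ·_)) ≡ ∑ⱽ k f) where

  ∑ⱽ-act : ∀ w f → ∑ⱽ k (f ∘ act _·_ w) ≡ ∑ⱽ k f
  ∑ⱽ-act []      f = refl
  ∑ⱽ-act (a ∷ w) f = trans (invariant a (f ∘ act _·_ w)) (∑ⱽ-act w f)

  -- Each visited arrangement merely reindexes the set of all tuples, so every term of the orbit sum
  -- has the same total.
  ∑ⱽ-orbitSum : ∀ π f → ∑ⱽ k (orbitSum _·_ π f) ≡ + length π * ∑ⱽ k f
  ∑ⱽ-orbitSum []      f = trans (∑ⱽ-const n k 0ℤ) (ℤP.*-zeroʳ ((+ n) ^ k))
  ∑ⱽ-orbitSum (w ∷ π) f = begin
    ∑ⱽ k (λ v → f (act _·_ w v) + orbitSum _·_ π f (act _·_ w v))  ≡⟨ ∑ⱽ-+ k (f ∘ act _·_ w) (orbitSum _·_ π f ∘ act _·_ w) ⟩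
    ∑ⱽ k (f ∘ act _·_ w) + ∑ⱽ k (orbitSum _·_ π f ∘ act _·_ w)     ≡⟨ cong₂ _+_ (∑ⱽ-act w f) (∑ⱽ-act w (orbitSum _·_ π f)) ⟩
    ∑ⱽ k f + ∑ⱽ k (orbitSum _·_ π f)                               ≡⟨ cong₂ _+_ (refl {x = ∑ⱽ k f}) (∑ⱽ-orbitSum π f) ⟩
    ∑ⱽ k f + + length π * ∑ⱽ k f                                   ≡⟨ ℤP.suc-* (+ length π) (∑ⱽ k f) ⟨
    + length (w ∷ π) * ∑ⱽ k f                                      ∎
    where open ≡-Reasoning

-- Coincidences within a tuple

δ : Fin n → Fin n → ℕ
δ a b = if ⌊ a ≟ b ⌋ then 1 else 0

hits : Fin n → Vec (Fin n) k → ℕ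
hits a []      = 0
hits a (b ∷ v) = δ a b ℕ.+ hits a v

collisions : Vec (Fin n) k → ℕ
collisions []      = 0
collisions (a ∷ v) = hits a v ℕ.+ collisions v

δ-suc : ∀ (a b : Fin n) → δ (suc a) (suc b) ≡ δ a b
δ-suc a b with a ≟ b
... | yes _ = refl
... | no  _ = refl

δ-sym : ∀ (a b : Fin n) → δ a b ≡ δ b a
δ-sym zero    zero    = refl
δ-sym zero    (suc b) = refl
δ-sym (suc a) zero    = refl
δ-sym (suc a) (suc b) = trans (δ-suc a b) (trans (δ-sym a b) (sym (δ-suc b a)))

sum-zero : ∀ n → sum {n} (λ _ → 0ℤ) ≡ 0ℤ
sum-zero n = trans (sum-const n 0ℤ) (ℤP.*-zeroʳ (+ n))

∑δ : ∀ (b : Fin n) → sum (λ a → + δ a b) ≡ + 1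
∑δ {suc n} zero    = cong₂ _+_ (refl {x = + 1}) (sum-zero n)
∑δ {suc n} (suc b) = trans (ℤP.+-identityˡ _) (trans (sum-cong-≗ λ a → cong +_ (δ-suc a b)) (∑δ b))

∑hits : ∀ (v : Vec (Fin n) k) → sum (λ a → + hits a v) ≡ + k
∑hits {n} []      = sum-zero n
∑hits     (b ∷ v) = trans (∑-distrib-+ (λ a → + δ a b) (λ a → + hits a v)) (cong₂ _+_ (∑δ b) (∑hits v))

pairs : ℕ → ℕ
pairs zero    = 0
pairs (suc k) = k ℕ.+ pairs k

-- Two given places agree in `(+ n) ^ k` tuples of length `suc k`. Counting non-injective tuples
-- with multiplicity replaces an estimate by an identity.
∑collisions : ∀ n k → ∑ⱽ {n} (suc k) (λ v → + collisions v) ≡ + pairs (suc k) * (+ n) ^ k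
∑collisions n k = begin
  sum {n} (λ a → ∑ⱽ k (λ v → + hits a v + + collisions v))
    ≡⟨ sum-cong-≗ {n} (λ a → ∑ⱽ-+ k (λ v → + hits a v) (λ v → + collisions v)) ⟩
  sum {n} (λ a → ∑ⱽ k (λ v → + hits a v) + ∑ⱽ k (λ v → + collisions v))
    ≡⟨ ∑-distrib-+ {n} (λ a → ∑ⱽ k (λ v → + hits a v)) (λ a → ∑ⱽ k (λ v → + collisions v)) ⟩
  sum {n} (λ a → ∑ⱽ k (λ v → + hits a v)) + sum {n} (λ _ → ∑ⱽ k (λ v → + collisions v))
    ≡⟨ cong₂ _+_ (trans (sym (∑ⱽ-sum k (λ a v → + hits a v)))
                        (trans (∑ⱽ-cong k ∑hits) (∑ⱽ-const n k (+ k))))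
                 (trans (sum-const n _) (rest k)) ⟩
  (+ n) ^ k * + k + + pairs k * (+ n) ^ k
    ≡⟨ collect ((+ n) ^ k) (+ k) (+ pairs k) ⟩
  + pairs (suc k) * (+ n) ^ k ∎
  where
  open ≡-Reasoning
  collect : ∀ x a b → x * a + b * x ≡ (a + b) * x
  collect = solve-∀
  exchange : ∀ x a b → x * (a * b) ≡ a * (x * b)
  exchange = solve-∀
  rest : ∀ k → + n * ∑ⱽ {n} k (λ v → + collisions v) ≡ + pairs k * (+ n) ^ k
  rest zero    = ℤP.*-zeroʳ (+ n)
  rest (suc k) = trans (cong (+ n *_) (∑collisions n k)) (exchange (+ n) (+ pairs (suc k)) ((+ n) ^ k))

hits-swapAt : ∀ i a (v : Vec (Fin n) (suc k)) → hits a (swapAt i v) ≡ hits a v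
hits-swapAt zero    a (b ∷ c ∷ v) = ℕ-leftSwap (δ a c) (δ a b) (hits a v)
hits-swapAt (suc i) a (b ∷ v)     = cong (δ a b ℕ.+_) (hits-swapAt i a v)

collisions-swapAt : ∀ i (v : Vec (Fin n) (suc k)) → collisions (swapAt i v) ≡ collisions v
collisions-swapAt zero (b ∷ c ∷ v) = begin
  δ c b ℕ.+ hits c v ℕ.+ (hits b v ℕ.+ collisions v)  ≡⟨ cong (λ d → d ℕ.+ hits c v ℕ.+ (hits b v ℕ.+ collisions v)) (δ-sym c b) ⟩
  δ b c ℕ.+ hits c v ℕ.+ (hits b v ℕ.+ collisions v)  ≡⟨ ℕ-interchange (δ b c) (hits c v) (hits b v) (collisions v) ⟩
  δ b c ℕ.+ hits b v ℕ.+ (hits c v ℕ.+ collisions v)  ∎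
  where
  open ≡-Reasoning
collisions-swapAt (suc i) (b ∷ v)     = cong₂ ℕ._+_ (hits-swapAt i b v) (collisions-swapAt i v)

δ-refl : ∀ (a : Fin n) → δ a a ≡ 1
δ-refl zero    = refl
δ-refl (suc a) = trans (δ-suc a a) (δ-refl a)

hits-missed : ∀ (v : Vec (Fin n) k) {a} → hits a v ≡ 0 → ∀ i → a ≢ Vec.lookup v i
hits-missed (b ∷ v) h zero    refl = ℕP.1+n≢0 (trans (sym (cong (ℕ._+ hits b v) (δ-refl b))) h)
hits-missed (b ∷ v) {a} h (suc i) eq = hits-missed v (ℕP.m+n≡0⇒n≡0 (δ a b) h) i eq

collisionFree⇒injective : ∀ (v : Vec (Fin n) k) → collisions v ≡ 0 → Injective _≡_ _≡_ (Vec.lookup v)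
collisionFree⇒injective (a ∷ v) h {zero}  {zero}  eq = refl
collisionFree⇒injective (a ∷ v) h {zero}  {suc j} eq = contradiction eq (hits-missed v (ℕP.m+n≡0⇒m≡0 (hits a v) h) j)
collisionFree⇒injective (a ∷ v) h {suc i} {zero}  eq = contradiction (sym eq) (hits-missed v (ℕP.m+n≡0⇒m≡0 (hits a v) h) i)
collisionFree⇒injective (a ∷ v) h {suc i} {suc j} eq = cong suc (collisionFree⇒injective v (ℕP.m+n≡0⇒n≡0 (hits a v) h) eq)

-- Orbit sums and equivariant maps

sumℤ-++ : ∀ xs ys → sumℤ (xs List.++ ys) ≡ sumℤ xs + sumℤ ys
sumℤ-++ []       ys = sym (ℤP.+-identityˡ (sumℤ ys))
sumℤ-++ (x ∷ xs) ys = trans (cong₂ _+_ (refl {x = x}) (sumℤ-++ xs ys)) (sym (ℤP.+-assoc x (sumℤ xs) (sumℤ ys)))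

sumℤ-concatMap : ∀ (f : A₂ → ℤ) (g : A₁ → List A₂) xs →
                 sumℤ (map f (concatMap g xs)) ≡ sumℤ (map (λ x → sumℤ (map f (g x))) xs)
sumℤ-concatMap f g []       = refl
sumℤ-concatMap f g (x ∷ xs) = begin
  sumℤ (map f (g x List.++ concatMap g xs))              ≡⟨ cong sumℤ (map-++ f (g x) (concatMap g xs)) ⟩
  sumℤ (map f (g x) List.++ map f (concatMap g xs))      ≡⟨ sumℤ-++ (map f (g x)) (map f (concatMap g xs)) ⟩
  sumℤ (map f (g x)) + sumℤ (map f (concatMap g xs))     ≡⟨ cong₂ _+_ (refl {x = sumℤ (map f (g x))}) (sumℤ-concatMap f g xs) ⟩
  sumℤ (map f (g x)) + sumℤ (map (λ x → sumℤ (map f (g x))) xs)  ∎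
  where open ≡-Reasoning

module _ {_·_ : A → A₁ → A₁} {_·′_ : A → A₂ → A₂} (h : A₁ → A₂) (equivariant : ∀ a p → h (a · p) ≡ a ·′ h p) where

  act-map : ∀ w p → h (act _·_ w p) ≡ act _·′_ w (h p)
  act-map []      p = refl
  act-map (a ∷ w) p = trans (act-map w (a · p)) (cong (act _·′_ w) (equivariant a p))

  visits-map : ∀ π p → map h (visits _·_ π p) ≡ visits _·′_ π (h p)
  visits-map []      p = refl
  visits-map (w ∷ π) p rewrite sym (act-map w p) = cong (h (act _·_ w p) ∷_) (visits-map π (act _·_ w p))

  -- This moves sums over orderings from vertex tuples to patterns and keys, where they can be
  -- evaluated.
  orbitSum-map : ∀ π {f : A₁ → ℤ} {g : A₂ → ℤ} → f ≗ g ∘ h → ∀ p → orbitSum _·_ π f p ≡ orbitSum _·′_ π g (h p)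
  orbitSum-map π {f} {g} f≗gh p = cong sumℤ (begin
    map f (visits _·_ π p)           ≡⟨ map-cong f≗gh (visits _·_ π p) ⟩
    map (g ∘ h) (visits _·_ π p)     ≡⟨ map-∘ (visits _·_ π p) ⟩
    map g (map h (visits _·_ π p))   ≡⟨ cong (map g) (visits-map π p) ⟩
    map g (visits _·′_ π (h p))      ∎)
    where open ≡-Reasoning

orbitSum-cong : ∀ {_·_ : A → A₁ → A₁} π {f g : A₁ → ℤ} → f ≗ g → ∀ p → orbitSum _·_ π f p ≡ orbitSum _·_ π g p
orbitSum-cong {_·_ = _·_} π f≗g p = cong sumℤ (map-cong f≗g (visits _·_ π p))

innerSum : (A → A₁ → A₁) → List (List (List A)) → (A₁ → ℤ) → A₁ → ℤ
innerSum _·_ []       f = f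
innerSum _·_ (π ∷ πs) f = innerSum _·_ πs (orbitSum _·_ π f)

innerVisits : (A → A₁ → A₁) → List (List (List A)) → A₁ → List A₁
innerVisits _·_ []       p = p ∷ []
innerVisits _·_ (π ∷ πs) p = concatMap (visits _·_ π) (innerVisits _·_ πs p)

innerSum-visits : ∀ (_·_ : A → A₁ → A₁) πs f p → innerSum _·_ πs f p ≡ sumℤ (map f (innerVisits _·_ πs p))
innerSum-visits _·_ []       f p = sym (ℤP.+-identityʳ (f p))
innerSum-visits _·_ (π ∷ πs) f p = trans (innerSum-visits _·_ πs (orbitSum _·_ π f) p)
                                         (sym (sumℤ-concatMap f (visits _·_ π) (innerVisits _·_ πs p)))

innerSum-map : ∀ {_·_ : A → A₁ → A₁} {_·′_ : A → A₂ → A₂} (h : A₁ → A₂) → (∀ a p → h (a · p) ≡ a ·′ h p) →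
               ∀ πs {f g} → f ≗ g ∘ h → ∀ p → innerSum _·_ πs f p ≡ innerSum _·′_ πs g (h p)
innerSum-map h eqv []       f≗gh = f≗gh
innerSum-map h eqv (π ∷ πs) f≗gh = innerSum-map h eqv πs (orbitSum-map h eqv π f≗gh)

innerVisits-map : ∀ {_·_ : A → A₁ → A₁} {_·′_ : A → A₂ → A₂} (h : A₁ → A₂) → (∀ a p → h (a · p) ≡ a ·′ h p) →
                  ∀ πs p → map h (innerVisits _·_ πs p) ≡ innerVisits _·′_ πs (h p)
innerVisits-map h eqv []       p = refl
innerVisits-map {_·_ = _·_} {_·′_} h eqv (π ∷ πs) p = begin
  map h (concatMap (visits _·_ π) ps)           ≡⟨ map-concatMap h (visits _·_ π) ps ⟩
  concatMap (map h ∘ visits _·_ π) ps           ≡⟨ cong List.concat (map-cong (visits-map h eqv π) ps) ⟩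
  concatMap (visits _·′_ π ∘ h) ps              ≡⟨ cong List.concat (map-∘ ps) ⟩
  concatMap (visits _·′_ π) (map h ps)          ≡⟨ cong (concatMap (visits _·′_ π)) (innerVisits-map h eqv πs p) ⟩
  concatMap (visits _·′_ π) (innerVisits _·′_ πs (h p)) ∎
  where
  open ≡-Reasoning
  ps = innerVisits _·_ πs p

lookupT-tabulate : ∀ (f : Vec Bool n → A) v → lookupT (tabulate n f) v ≡ f v
lookupT-tabulate f []          = refl
lookupT-tabulate f (false ∷ v) = lookupT-tabulate (f ∘ (false ∷_)) v
lookupT-tabulate f (true ∷ v)  = lookupT-tabulate (f ∘ (true ∷_)) v

fromVec-toVec : ∀ κ → fromVec (toVec κ) ≡ κ
fromVec-toVec (key _ _ _ _ _ _ _ _ _ _ _ _ _ _ _ _) = refl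

recall-memo : ∀ f → recall (memo f) ≗ f
recall-memo f κ = trans (lookupT-tabulate (f ∘ fromVec) (toVec κ)) (cong f (fromVec-toVec κ))

innerSum-cong : ∀ (_·_ : A → A₁ → A₁) πs {f g} → f ≗ g → innerSum _·_ πs f ≗ innerSum _·_ πs g
innerSum-cong _·_ πs f≗g = innerSum-map (λ p → p) (λ _ _ → refl) πs f≗g

-- Storing a stage before the next one uses it affects the cost, not the values.
recall-stages : ∀ πs t → recall (stages πs t) ≗ innerSum swapKey πs (recall t)
recall-stages []       t κ = refl
recall-stages (π ∷ πs) t κ = trans (recall-stages πs (memo (orbitSum swapKey π (recall t))) κ)
                                   (innerSum-cong swapKey πs (recall-memo (orbitSum swapKey π (recall t))) κ)

-- Invariance of the sum over orderings under S₆

-- `punchIn 3F` skips the swap of d and x and sends `3F` to the swap of x and y, in agreement with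
-- `swapKey`.
swapInner : Fin 4 → Vec A 6 → Vec A 6
swapInner i = swapAt (punchIn 3F i)

swapAt-map : ∀ {A₁ : Set} (h : A → A₁) (i : Fin n) v → Vec.map h (swapAt i v) ≡ swapAt i (Vec.map h v)
swapAt-map h zero    (a ∷ b ∷ v) = refl
swapAt-map h (suc i) (a ∷ v)     = cong (h a ∷_) (swapAt-map h i v)

module Symmetrise (π : List (List (Fin 5))) (πs : List (List (List (Fin 4)))) where

  symmetrise : (Vec A 6 → ℤ) → Vec A 6 → ℤ
  symmetrise f = orbitSum swapAt π (innerSum swapInner πs f)

  arrangements : Vec A 6 → List (Vec A 6)
  arrangements v = concatMap (innerVisits swapInner πs) (visits swapAt π v)

  symmetrise-arrangements : ∀ (f : Vec A 6 → ℤ) v → symmetrise f v ≡ sumℤ (map f (arrangements v))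
  symmetrise-arrangements f v = trans (orbitSum-cong π (innerSum-visits swapInner πs f) v)
                                      (sym (sumℤ-concatMap f (innerVisits swapInner πs) (visits swapAt π v)))

  -- Arrangements move places and never inspect entries. This naturality reduces statements about
  -- all tuples to the tuple of the six places.
  arrangements-map : ∀ {A₁ : Set} (h : A → A₁) v → map (Vec.map h) (arrangements v) ≡ arrangements (Vec.map h v)
  arrangements-map h v = begin
    map (Vec.map h) (concatMap inner vs)     ≡⟨ map-concatMap (Vec.map h) inner vs ⟩
    concatMap (map (Vec.map h) ∘ inner) vs   ≡⟨ cong List.concat (map-cong (innerVisits-map (Vec.map h) (λ i → swapAt-map h (punchIn 3F i)) πs) vs) ⟩
    concatMap (inner ∘ Vec.map h) vs         ≡⟨ cong List.concat (map-∘ vs) ⟩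
    concatMap inner (map (Vec.map h) vs)     ≡⟨ cong (concatMap inner) (visits-map (Vec.map h) (swapAt-map h) π v) ⟩
    arrangements (Vec.map h v)               ∎
    where
    open ≡-Reasoning
    inner : ∀ {A} → Vec A 6 → List (Vec A 6)
    inner = innerVisits swapInner πs
    vs = visits swapAt π v

-- Base 6 numerals, lowest digit first: two tuples are compared by one equality test of natural
-- numbers.
encode : Vec (Fin 6) k → ℕ
encode []      = 0
encode (a ∷ v) = toℕ a ℕ.+ encode v ℕ.* 6

encode-injective : ∀ (u v : Vec (Fin 6) k) → encode u ≡ encode v → u ≡ v
encode-injective []      []      eq = refl
encode-injective (a ∷ u) (b ∷ v) eq = cong₂ _∷_ (toℕ-injective a≡b) (encode-injective u v (ℕP.*-cancelʳ-≡ (encode u) (encode v) 6 rest))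
  where
  head≡ : ∀ {k} (a : Fin 6) (v : Vec (Fin 6) k) → encode (a ∷ v) ℕ.% 6 ≡ toℕ a
  head≡ a v = trans ([m+kn]%n≡m%n (toℕ a) (encode v) 6) (m<n⇒m%n≡m (toℕ<n a))
  a≡b : toℕ a ≡ toℕ b
  a≡b = trans (sym (head≡ a u)) (trans (cong (ℕ._% 6) eq) (head≡ b v))
  rest : encode u ℕ.* 6 ≡ encode v ℕ.* 6
  rest = ℕP.+-cancelˡ-≡ (toℕ a) _ _ (trans eq (cong (ℕ._+ encode v ℕ.* 6) (sym a≡b)))

-- The proof component keeps the code of a tuple shared between all comparisons that involve it.
Coded : Set
Coded = Σ (Vec (Fin 6) 6) λ v → Σ ℕ λ c → encode v ≡ c

coded : Vec (Fin 6) 6 → Coded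
coded v = v , encode v , refl

removeCode : ℕ → List Coded → Maybe (List Coded)
removeCode c []                    = nothing
removeCode c (q@(_ , d , _) ∷ qs) = if c ≡ᵇ d then just qs else Maybe.map (q ∷_) (removeCode c qs)

-- Equality as multisets, by successive deletion.
rearranged : List Coded → List Coded → Bool
rearrangedRest : Maybe (List Coded) → List Coded → Bool
rearranged []                []      = true
rearranged []                (_ ∷ _) = false
rearranged ((_ , c , _) ∷ ps) qs     = rearrangedRest (removeCode c qs) ps
rearrangedRest nothing   ps = false
rearrangedRest (just qs) ps = rearranged ps qs

module _ (f : Vec (Fin 6) 6 → ℤ) where

  sumCoded : List Coded → ℤ
  sumCoded qs = sumℤ (map (f ∘ proj₁) qs)

  removeCode-sum : ∀ (p : Coded) qs {rs} → removeCode (proj₁ (proj₂ p)) qs ≡ just rs → sumCoded qs ≡ f (proj₁ p) + sumCoded rs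
  removeCode-sum p@(v , c , refl) (q@(w , d , refl) ∷ qs) eq with c ≡ᵇ d in c≡ᵇd
  removeCode-sum p@(v , c , refl) (q@(w , d , refl) ∷ qs) refl | true =
    cong (λ u → f u + sumCoded qs) (encode-injective w v (sym (ℕP.≡ᵇ⇒≡ c d (subst T (sym c≡ᵇd) tt))))
  removeCode-sum p@(v , c , refl) (q@(w , d , refl) ∷ qs) eq | false with removeCode c qs in eq′
  removeCode-sum p@(v , c , refl) (q@(w , d , refl) ∷ qs) refl | false | just rs = begin
    f w + sumCoded qs          ≡⟨ cong₂ _+_ (refl {x = f w}) (removeCode-sum p qs eq′) ⟩
    f w + (f v + sumCoded rs)  ≡⟨ ℤ-leftSwap (f w) (f v) (sumCoded rs) ⟩
    f v + (f w + sumCoded rs)  ∎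
    where open ≡-Reasoning

  rearranged-sum : ∀ ps qs → rearranged ps qs ≡ true → sumCoded ps ≡ sumCoded qs
  rearranged-sum []       []      _  = refl
  rearranged-sum (p ∷ ps) qs      eq with removeCode (proj₁ (proj₂ p)) qs in eq′
  ... | just rs = trans (cong₂ _+_ (refl {x = f (proj₁ p)}) (rearranged-sum ps rs eq)) (sym (removeCode-sum p qs eq′))

module Invariance (π : List (List (Fin 5))) (πs : List (List (List (Fin 4)))) where

  open Symmetrise π πs

  -- It suffices that a generator leaves the multiset of arrangements unchanged; that each ordering
  -- occurs exactly once does not have to be shown.
  Closed : Set
  Closed = ∀ i → rearranged (map coded (arrangements (swapAt i (Vec.allFin 6)))) (map coded (arrangements (Vec.allFin 6))) ≡ true

  -- A tuple is the image of the six places under `Vec.lookup v`, so by naturality the closure of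
  -- one list of arrangements gives invariance for every `f` and `v`.
  symmetrise-swapAt : Closed → ∀ (f : Vec A 6 → ℤ) i v → symmetrise f (swapAt i v) ≡ symmetrise f v
  symmetrise-swapAt closed f i v = begin
    symmetrise f (swapAt i v)                           ≡⟨ cong (symmetrise f ∘ swapAt i) (map-lookup-allFin v) ⟨
    symmetrise f (swapAt i (Vec.map (Vec.lookup v) ι))  ≡⟨ cong (symmetrise f) (swapAt-map (Vec.lookup v) i ι) ⟨
    symmetrise f (Vec.map (Vec.lookup v) (swapAt i ι))  ≡⟨ pull (swapAt i ι) ⟩
    sumCoded g (map coded (arrangements (swapAt i ι)))  ≡⟨ rearranged-sum g (map coded (arrangements (swapAt i ι))) (map coded (arrangements ι)) (closed i) ⟩
    sumCoded g (map coded (arrangements ι))             ≡⟨ pull ι ⟨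
    symmetrise f (Vec.map (Vec.lookup v) ι)             ≡⟨ cong (symmetrise f) (map-lookup-allFin v) ⟩
    symmetrise f v                                      ∎
    where
    open ≡-Reasoning
    ι = Vec.allFin 6
    g : Vec (Fin 6) 6 → ℤ
    g = f ∘ Vec.map (Vec.lookup v)
    pull : ∀ u → symmetrise f (Vec.map (Vec.lookup v) u) ≡ sumCoded g (map coded (arrangements u))
    pull u = begin
      symmetrise f (Vec.map (Vec.lookup v) u)                     ≡⟨ symmetrise-arrangements f (Vec.map (Vec.lookup v) u) ⟩
      sumℤ (map f (arrangements (Vec.map (Vec.lookup v) u)))      ≡⟨ cong (sumℤ ∘ map f) (arrangements-map (Vec.lookup v) u) ⟨
      sumℤ (map f (map (Vec.map (Vec.lookup v)) (arrangements u))) ≡⟨ cong sumℤ (map-∘ (arrangements u)) ⟨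
      sumℤ (map g (arrangements u))                               ≡⟨ cong sumℤ (map-∘ (arrangements u)) ⟩
      sumCoded g (map coded (arrangements u))                     ∎

-- Soundness of the finite check

∨-true : ∀ x {y} → x ∨ y ≡ true → x ≡ true ⊎ y ≡ true
∨-true true  eq = inj₁ refl
∨-true false eq = inj₂ eq

∧-true : ∀ x {y} → x ∧ y ≡ true → x ≡ true × y ≡ true
∧-true true eq = refl , eq

allVec-sound : ∀ n (f : Vec Bool n → Bool) → allVec n f ≡ true → ∀ v → f v ≡ true
allVec-sound zero    f eq []          = eq
allVec-sound (suc n) f eq (false ∷ v) = allVec-sound n (f ∘ (false ∷_)) (proj₁ (∧-true _ eq)) v
allVec-sound (suc n) f eq (true ∷ v)  = allVec-sound n (f ∘ (true ∷_)) (proj₂ (∧-true (allVec n (f ∘ (false ∷_))) eq)) v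

guardedAll-sound : ∀ m n f g → guardedAll m n f g ≡ true → ∀ v w → f v ≡ true ⊎ g v w ≡ true
guardedAll-sound m n f g eq v w with ∨-true (f v) (allVec-sound m (λ v → f v ∨ allVec n (g v)) eq v)
... | inj₁ h = inj₁ h
... | inj₂ h = inj₂ (allVec-sound n (g v) h w)

==-sound : ∀ a b → a == b ≡ true → a ≡ b
==-sound true  true  _ = refl
==-sound false false _ = refl

module _ (ws π : List (List (Fin 5))) where

  data Outcome (t : Trie ℤ 16) (p : Pattern) : Set where
    descent : ∀ i → descends i p ≡ true → Outcome t p
    empty   : empty₄ p ≡ true → Outcome t p
    I₄-copy : hasI₄ π p ≡ true → Outcome t p
    M₂-copy : isM₂ ws p ≡ true → Outcome t p
    heavy   : averageOk π t p ≡ true → Outcome t p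

  prefixOut-outcome : ∀ {t} p → prefixOut p ≡ true → Outcome t p
  prefixOut-outcome p eq with ∨-true (empty₄ p) eq
  ... | inj₁ e = empty e
  ... | inj₂ eq with ∨-true (descends 0F p) eq
  ... | inj₁ d = descent 0F d
  ... | inj₂ eq with ∨-true (descends 1F p) eq
  ... | inj₁ d = descent 1F d
  ... | inj₂ eq with ∨-true (descends 2F p) eq
  ... | inj₁ d = descent 2F d
  ... | inj₂ d = descent 3F d

  extOk-outcome : ∀ t p → extOk ws π t p ≡ true → Outcome t p
  extOk-outcome t p eq with ∨-true (descends 4F p) eq
  ... | inj₁ d = descent 4F d
  ... | inj₂ eq with ∨-true (hasI₄ π p) eq
  ... | inj₁ h = I₄-copy h
  ... | inj₂ eq with ∨-true (averageOk π t p) eq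
  ... | inj₁ g = heavy g
  ... | inj₂ h = M₂-copy h

  code-cong : ∀ (v v′ w : Vec Bool 10) → code (toPattern (v ++ v′)) ≡ code (toPattern (v ++ w))
  code-cong (_ ∷ _ ∷ _ ∷ _ ∷ _ ∷ _ ∷ _ ∷ _ ∷ _ ∷ _ ∷ []) (_ ∷ _ ∷ _ ∷ _ ∷ _ ∷ _ ∷ _ ∷ _ ∷ _ ∷ _ ∷ []) (_ ∷ _ ∷ _ ∷ _ ∷ _ ∷ _ ∷ _ ∷ _ ∷ _ ∷ _ ∷ []) = refl

  code-swap-cong : ∀ (i : Fin 4) (v v′ w : Vec Bool 10) →
                   code (swapBits (inject₁ i) (toPattern (v ++ v′))) ≡ code (swapBits (inject₁ i) (toPattern (v ++ w)))
  code-swap-cong 0F (_ ∷ _ ∷ _ ∷ _ ∷ _ ∷ _ ∷ _ ∷ _ ∷ _ ∷ _ ∷ []) (_ ∷ _ ∷ _ ∷ _ ∷ _ ∷ _ ∷ _ ∷ _ ∷ _ ∷ _ ∷ []) (_ ∷ _ ∷ _ ∷ _ ∷ _ ∷ _ ∷ _ ∷ _ ∷ _ ∷ _ ∷ []) = refl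
  code-swap-cong 1F (_ ∷ _ ∷ _ ∷ _ ∷ _ ∷ _ ∷ _ ∷ _ ∷ _ ∷ _ ∷ []) (_ ∷ _ ∷ _ ∷ _ ∷ _ ∷ _ ∷ _ ∷ _ ∷ _ ∷ _ ∷ []) (_ ∷ _ ∷ _ ∷ _ ∷ _ ∷ _ ∷ _ ∷ _ ∷ _ ∷ _ ∷ []) = refl
  code-swap-cong 2F (_ ∷ _ ∷ _ ∷ _ ∷ _ ∷ _ ∷ _ ∷ _ ∷ _ ∷ _ ∷ []) (_ ∷ _ ∷ _ ∷ _ ∷ _ ∷ _ ∷ _ ∷ _ ∷ _ ∷ _ ∷ []) (_ ∷ _ ∷ _ ∷ _ ∷ _ ∷ _ ∷ _ ∷ _ ∷ _ ∷ _ ∷ []) = refl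
  code-swap-cong 3F (_ ∷ _ ∷ _ ∷ _ ∷ _ ∷ _ ∷ _ ∷ _ ∷ _ ∷ _ ∷ []) (_ ∷ _ ∷ _ ∷ _ ∷ _ ∷ _ ∷ _ ∷ _ ∷ _ ∷ _ ∷ []) (_ ∷ _ ∷ _ ∷ _ ∷ _ ∷ _ ∷ _ ∷ _ ∷ _ ∷ _ ∷ []) = refl

  empty₄-cong : ∀ (v v′ w : Vec Bool 10) → empty₄ (toPattern (v ++ v′)) ≡ empty₄ (toPattern (v ++ w))
  empty₄-cong (false ∷ false ∷ false ∷ false ∷ _ ∷ _ ∷ _ ∷ _ ∷ _ ∷ _ ∷ []) (_ ∷ _ ∷ _ ∷ _ ∷ _ ∷ _ ∷ _ ∷ _ ∷ _ ∷ _ ∷ []) (_ ∷ _ ∷ _ ∷ _ ∷ _ ∷ _ ∷ _ ∷ _ ∷ _ ∷ _ ∷ []) = refl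
  empty₄-cong (false ∷ false ∷ false ∷ true ∷ _ ∷ _ ∷ _ ∷ _ ∷ _ ∷ _ ∷ []) (_ ∷ _ ∷ _ ∷ _ ∷ _ ∷ _ ∷ _ ∷ _ ∷ _ ∷ _ ∷ []) (_ ∷ _ ∷ _ ∷ _ ∷ _ ∷ _ ∷ _ ∷ _ ∷ _ ∷ _ ∷ []) = refl
  empty₄-cong (false ∷ false ∷ true ∷ _ ∷ _ ∷ _ ∷ _ ∷ _ ∷ _ ∷ _ ∷ []) (_ ∷ _ ∷ _ ∷ _ ∷ _ ∷ _ ∷ _ ∷ _ ∷ _ ∷ _ ∷ []) (_ ∷ _ ∷ _ ∷ _ ∷ _ ∷ _ ∷ _ ∷ _ ∷ _ ∷ _ ∷ []) = refl
  empty₄-cong (false ∷ true ∷ _ ∷ _ ∷ _ ∷ _ ∷ _ ∷ _ ∷ _ ∷ _ ∷ []) (_ ∷ _ ∷ _ ∷ _ ∷ _ ∷ _ ∷ _ ∷ _ ∷ _ ∷ _ ∷ []) (_ ∷ _ ∷ _ ∷ _ ∷ _ ∷ _ ∷ _ ∷ _ ∷ _ ∷ _ ∷ []) = refl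
  empty₄-cong (true ∷ _ ∷ _ ∷ _ ∷ _ ∷ _ ∷ _ ∷ _ ∷ _ ∷ _ ∷ []) (_ ∷ _ ∷ _ ∷ _ ∷ _ ∷ _ ∷ _ ∷ _ ∷ _ ∷ _ ∷ []) (_ ∷ _ ∷ _ ∷ _ ∷ _ ∷ _ ∷ _ ∷ _ ∷ _ ∷ _ ∷ []) = refl

  -- The first four swaps keep the first five vertices together, so the guard reads only the first
  -- ten bits. This justifies deciding it once per prefix.
  prefixOut-cong : ∀ (v v′ w : Vec Bool 10) → prefixOut (toPattern (v ++ v′)) ≡ prefixOut (toPattern (v ++ w))
  prefixOut-cong v v′ w = cong₂ _∨_ (empty₄-cong v v′ w)
    (cong₂ _∨_ (d 0F) (cong₂ _∨_ (d 1F) (cong₂ _∨_ (d 2F) (d 3F))))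
    where
    d : ∀ (i : Fin 4) → descends (inject₁ i) (toPattern (v ++ v′)) ≡ descends (inject₁ i) (toPattern (v ++ w))
    d i = cong₂ _<ᵇ_ (code-swap-cong i v v′ w) (code-cong v v′ w)

  Certificate : Trie ℤ 16 → Set
  Certificate t = guardedAll 10 10 prefixCheck (extCheck ws π t) ≡ true

  outcomeVec : ∀ t → Certificate t → ∀ (v v′ : Vec Bool 10) → Outcome t (toPattern (v ++ v′))
  outcomeVec t c v v′ = cases (guardedAll-sound 10 10 prefixCheck (extCheck ws π t) (c) v v′)
    where
    cases : prefixCheck v ≡ true ⊎ extCheck ws π t v v′ ≡ true → Outcome t (toPattern (v ++ v′))
    cases (inj₁ out) = prefixOut-outcome (toPattern (v ++ v′)) (subst (_≡ true) (prefixOut-cong v (Vec.replicate 10 false) v′) out)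
    cases (inj₂ ok)  = extOk-outcome t (toPattern (v ++ v′)) ok

  outcome : ∀ t → Certificate t → ∀ p → Outcome t p
  outcome t eq (pattern₆ s₀ s₁ s₂ s₃ x₀ x₁ x₂ x₃ x₄ x₅ y₀ y₁ y₂ y₃ y₄ y₅ z₀ z₁ z₂ z₃) =
    outcomeVec t eq (s₀ ∷ s₁ ∷ s₂ ∷ s₃ ∷ x₀ ∷ x₁ ∷ x₂ ∷ x₃ ∷ x₄ ∷ x₅ ∷ [])
                    (y₀ ∷ y₁ ∷ y₂ ∷ y₃ ∷ y₄ ∷ y₅ ∷ z₀ ∷ z₁ ∷ z₂ ∷ z₃ ∷ [])

-- Induced copies read off from patterns

-- A computed order: for closed indices the failing cases are empty by evaluation, which leaves only
-- the increasing triples to treat.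
_<ᶠ_ : Fin m → Fin m → Set
i <ᶠ j = T (toℕ i <ᵇ toℕ j)

≈ᵇ-sound : ∀ (u v : Vec Bool n) → u ≈ᵇ v ≡ true → u ≡ v
≈ᵇ-sound []      []      _  = refl
≈ᵇ-sound (a ∷ u) (b ∷ v) eq with ∧-true (a == b) eq
... | a==b , u≈v = cong₂ _∷_ (==-sound a b a==b) (≈ᵇ-sound u v u≈v)

module _ (F : 3Graph m) (G : 3Graph n) (f : Fin m → Fin n)
         (agree : ∀ i j k → i <ᶠ j → j <ᶠ k → edge F i j k ≡ edge G (f i) (f j) (f k)) where

  private
    Agree : Fin m → Fin m → Fin m → Set
    Agree i j k = edge F i j k ≡ edge G (f i) (f j) (f k)

    flip₁ : ∀ {i j k} → Agree j i k → Agree i j k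
    flip₁ {i} {j} {k} eq = trans (sym₁ F i j k) (trans eq (sym₁ G (f j) (f i) (f k)))

    flip₂ : ∀ {i j k} → Agree i k j → Agree i j k
    flip₂ {i} {j} {k} eq = trans (sym₂ F i j k) (trans eq (sym₂ G (f i) (f k) (f j)))

    order : ∀ {i j : Fin m} → i ≢ j → i <ᶠ j ⊎ j <ᶠ i
    order {i} {j} i≢j with ℕP.<-cmp (toℕ i) (toℕ j)
    ... | tri< i<j _ _ = inj₁ (ℕP.<⇒<ᵇ i<j)
    ... | tri≈ _ i≡j _ = contradiction (toℕ-injective i≡j) i≢j
    ... | tri> _ _ j<i = inj₂ (ℕP.<⇒<ᵇ j<i)

  -- Both edge functions are symmetric, so the increasing triples decide all triples of distinct
  -- vertices.
  agree-distinct : ∀ i j k → i ≢ j → j ≢ k → i ≢ k → Agree i j k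
  agree-distinct i j k i≢j j≢k i≢k with order i≢j | order j≢k | order i≢k
  ... | inj₁ i<j | inj₁ j<k | _        = agree i j k i<j j<k
  ... | inj₁ i<j | inj₂ k<j | inj₁ i<k = flip₂ (agree i k j i<k k<j)
  ... | inj₁ i<j | inj₂ k<j | inj₂ k<i = flip₂ (flip₁ (agree k i j k<i i<j))
  ... | inj₂ j<i | inj₁ j<k | inj₁ i<k = flip₁ (agree j i k j<i i<k)
  ... | inj₂ j<i | inj₁ j<k | inj₂ k<i = flip₁ (flip₂ (agree j k i j<k k<i))
  ... | inj₂ j<i | inj₂ k<j | _        = flip₂ (flip₁ (flip₂ (agree k j i k<j j<i)))

module Copies (G : 3Graph n) where

  e : Fin n → Fin n → Fin n → Bool
  e = edge G

  e-sym₁ : ∀ a b c → e a b c ≡ e b a c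
  e-sym₁ = sym₁ G

  e-sym₂ : ∀ a b c → e a b c ≡ e a c b
  e-sym₂ = sym₂ G

  -- Only the four triples that contain both swapped vertices see their arguments reordered and need
  -- symmetry; the others just change place.
  bits-swap : ∀ i (v : Vec (Fin n) 6) → bits e (swapAt i v) ≡ swapBits i (bits e v)
  bits-swap 0F (a ∷ b ∷ c ∷ d ∷ x ∷ y ∷ [])
    rewrite e-sym₁ b a c | e-sym₁ b a d | e-sym₁ b a x | e-sym₁ b a y = refl
  bits-swap 1F (a ∷ b ∷ c ∷ d ∷ x ∷ y ∷ [])
    rewrite e-sym₂ a c b | e-sym₁ c b d | e-sym₁ c b x | e-sym₁ c b y = refl
  bits-swap 2F (a ∷ b ∷ c ∷ d ∷ x ∷ y ∷ [])
    rewrite e-sym₂ a d c | e-sym₂ b d c | e-sym₁ d c x | e-sym₁ d c y = refl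
  bits-swap 3F (a ∷ b ∷ c ∷ d ∷ x ∷ y ∷ [])
    rewrite e-sym₂ a x d | e-sym₂ b x d | e-sym₂ c x d | e-sym₁ x d y = refl
  bits-swap 4F (a ∷ b ∷ c ∷ d ∷ x ∷ y ∷ [])
    rewrite e-sym₂ a y x | e-sym₂ b y x | e-sym₂ c y x | e-sym₂ d y x = refl

  -- The index in each clause is the place of the triple in the order fixed by `bits`.
  edge-M₂ : ∀ v → flatten (bits e v) ≡ flatten M₂-pattern → ∀ i j k → i <ᶠ j → j <ᶠ k →
            edge M2 i j k ≡ e (Vec.lookup v i) (Vec.lookup v j) (Vec.lookup v k)
  edge-M₂ (a ∷ b ∷ c ∷ d ∷ x ∷ y ∷ []) eq 0F 1F 2F _ _ = sym (cong (λ u → Vec.lookup u (# 0)) eq)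
  edge-M₂ (a ∷ b ∷ c ∷ d ∷ x ∷ y ∷ []) eq 0F 1F 3F _ _ = sym (cong (λ u → Vec.lookup u (# 1)) eq)
  edge-M₂ (a ∷ b ∷ c ∷ d ∷ x ∷ y ∷ []) eq 0F 2F 3F _ _ = sym (cong (λ u → Vec.lookup u (# 2)) eq)
  edge-M₂ (a ∷ b ∷ c ∷ d ∷ x ∷ y ∷ []) eq 1F 2F 3F _ _ = sym (cong (λ u → Vec.lookup u (# 3)) eq)
  edge-M₂ (a ∷ b ∷ c ∷ d ∷ x ∷ y ∷ []) eq 0F 1F 4F _ _ = sym (cong (λ u → Vec.lookup u (# 4)) eq)
  edge-M₂ (a ∷ b ∷ c ∷ d ∷ x ∷ y ∷ []) eq 0F 2F 4F _ _ = sym (cong (λ u → Vec.lookup u (# 5)) eq)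
  edge-M₂ (a ∷ b ∷ c ∷ d ∷ x ∷ y ∷ []) eq 0F 3F 4F _ _ = sym (cong (λ u → Vec.lookup u (# 6)) eq)
  edge-M₂ (a ∷ b ∷ c ∷ d ∷ x ∷ y ∷ []) eq 1F 2F 4F _ _ = sym (cong (λ u → Vec.lookup u (# 7)) eq)
  edge-M₂ (a ∷ b ∷ c ∷ d ∷ x ∷ y ∷ []) eq 1F 3F 4F _ _ = sym (cong (λ u → Vec.lookup u (# 8)) eq)
  edge-M₂ (a ∷ b ∷ c ∷ d ∷ x ∷ y ∷ []) eq 2F 3F 4F _ _ = sym (cong (λ u → Vec.lookup u (# 9)) eq)
  edge-M₂ (a ∷ b ∷ c ∷ d ∷ x ∷ y ∷ []) eq 0F 1F 5F _ _ = sym (cong (λ u → Vec.lookup u (# 10)) eq)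
  edge-M₂ (a ∷ b ∷ c ∷ d ∷ x ∷ y ∷ []) eq 0F 2F 5F _ _ = sym (cong (λ u → Vec.lookup u (# 11)) eq)
  edge-M₂ (a ∷ b ∷ c ∷ d ∷ x ∷ y ∷ []) eq 0F 3F 5F _ _ = sym (cong (λ u → Vec.lookup u (# 12)) eq)
  edge-M₂ (a ∷ b ∷ c ∷ d ∷ x ∷ y ∷ []) eq 1F 2F 5F _ _ = sym (cong (λ u → Vec.lookup u (# 13)) eq)
  edge-M₂ (a ∷ b ∷ c ∷ d ∷ x ∷ y ∷ []) eq 1F 3F 5F _ _ = sym (cong (λ u → Vec.lookup u (# 14)) eq)
  edge-M₂ (a ∷ b ∷ c ∷ d ∷ x ∷ y ∷ []) eq 2F 3F 5F _ _ = sym (cong (λ u → Vec.lookup u (# 15)) eq)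
  edge-M₂ (a ∷ b ∷ c ∷ d ∷ x ∷ y ∷ []) eq 0F 4F 5F _ _ = sym (cong (λ u → Vec.lookup u (# 16)) eq)
  edge-M₂ (a ∷ b ∷ c ∷ d ∷ x ∷ y ∷ []) eq 1F 4F 5F _ _ = sym (cong (λ u → Vec.lookup u (# 17)) eq)
  edge-M₂ (a ∷ b ∷ c ∷ d ∷ x ∷ y ∷ []) eq 2F 4F 5F _ _ = sym (cong (λ u → Vec.lookup u (# 18)) eq)
  edge-M₂ (a ∷ b ∷ c ∷ d ∷ x ∷ y ∷ []) eq 3F 4F 5F _ _ = sym (cong (λ u → Vec.lookup u (# 19)) eq)

  copy-M₂ : ∀ v → collisions v ≡ 0 → flatten (bits e v) ≈ᵇ flatten M₂-pattern ≡ true → InducedCopy M2 G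
  copy-M₂ v free eq = Vec.lookup v , (λ {i} {j} → collisionFree⇒injective v free {i} {j}) ,
    agree-distinct M2 G (Vec.lookup v) (edge-M₂ v (≈ᵇ-sound (flatten (bits e v)) (flatten M₂-pattern) eq))

  edge-I₄ : ∀ v → empty₄ (bits e v) ≡ true → ∀ (i j k : Fin 4) → i <ᶠ j → j <ᶠ k →
            false ≡ e (Vec.lookup v (i ↑ˡ 2)) (Vec.lookup v (j ↑ˡ 2)) (Vec.lookup v (k ↑ˡ 2))
  edge-I₄ (a ∷ b ∷ c ∷ d ∷ x ∷ y ∷ []) eq i j k i<j j<k
    with e a b c in abc | e a b d in abd | e a c d in acd | e b c d in bcd
  -- Any other values of the four bits turn `eq` into `false ≡ true`.
  edge-I₄ (a ∷ b ∷ c ∷ d ∷ x ∷ y ∷ []) eq 0F 1F 2F _ _ | false | false | false | false = sym abc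
  edge-I₄ (a ∷ b ∷ c ∷ d ∷ x ∷ y ∷ []) eq 0F 1F 3F _ _ | false | false | false | false = sym abd
  edge-I₄ (a ∷ b ∷ c ∷ d ∷ x ∷ y ∷ []) eq 0F 2F 3F _ _ | false | false | false | false = sym acd
  edge-I₄ (a ∷ b ∷ c ∷ d ∷ x ∷ y ∷ []) eq 1F 2F 3F _ _ | false | false | false | false = sym bcd

  copy-I₄ : ∀ v → collisions v ≡ 0 → empty₄ (bits e v) ≡ true → InducedCopy I34 G
  copy-I₄ v free eq = (λ i → Vec.lookup v (i ↑ˡ 2)) , injective ,
    agree-distinct I34 G (λ i → Vec.lookup v (i ↑ˡ 2)) (edge-I₄ v eq)
    where
    injective : Injective _≡_ _≡_ (λ (i : Fin 4) → Vec.lookup v (i ↑ˡ 2))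
    injective eq = ↑ˡ-injective 2 _ _ (collisionFree⇒injective v free eq)

  collisions-act : ∀ w v → collisions (act swapAt w v) ≡ collisions {n} {6} v
  collisions-act []      v = refl
  collisions-act (i ∷ w) v = trans (collisions-act w (swapAt i v)) (collisions-swapAt i v)

  find-I₄ : ∀ π v → collisions v ≡ 0 → any empty₄ (visits swapBits π (bits e v)) ≡ true → InducedCopy I34 G
  find-I₄ π v free eq = go π v free (subst (λ ps → any empty₄ ps ≡ true) (sym (visits-map (bits e) bits-swap π v)) eq)
    where
    go : ∀ π v → collisions v ≡ 0 → any empty₄ (map (bits e) (visits swapAt π v)) ≡ true → InducedCopy I34 G
    go (w ∷ π) v free eq with ∨-true (empty₄ (bits e (act swapAt w v))) eq
    ... | inj₁ here  = copy-I₄ (act swapAt w v) (trans (collisions-act w v) free) here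
    ... | inj₂ later = go π (act swapAt w v) (trans (collisions-act w v) free) later

  find-M₂ : ∀ ws v → collisions v ≡ 0 →
            any (λ w → flatten (act swapBits w (bits e v)) ≈ᵇ flatten M₂-pattern) ws ≡ true → InducedCopy M2 G
  find-M₂ (w ∷ ws) v free eq with ∨-true (flatten (act swapBits w (bits e v)) ≈ᵇ flatten M₂-pattern) eq
  ... | inj₁ copy  = copy-M₂ (act swapAt w v) (trans (collisions-act w v) free)
    (subst (λ p → flatten p ≈ᵇ flatten M₂-pattern ≡ true) (sym (act-map (bits e) bits-swap w v)) copy)
  ... | inj₂ later = find-M₂ ws v free later

  toKey-swapBits : ∀ i p → toKey (swapBits (punchIn 3F i) p) ≡ swapKey i (toKey p)
  toKey-swapBits 0F (pattern₆ _ _ _ _ _ _ _ _ _ _ _ _ _ _ _ _ _ _ _ _) = refl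
  toKey-swapBits 1F (pattern₆ _ _ _ _ _ _ _ _ _ _ _ _ _ _ _ _ _ _ _ _) = refl
  toKey-swapBits 2F (pattern₆ _ _ _ _ _ _ _ _ _ _ _ _ _ _ _ _ _ _ _ _) = refl
  toKey-swapBits 3F (pattern₆ _ _ _ _ _ _ _ _ _ _ _ _ _ _ _ _ _ _ _ _) = refl

  keyOf : Vec (Fin n) 6 → Key
  keyOf v = toKey (bits e v)

  keyOf-swap : ∀ i v → keyOf (swapInner i v) ≡ swapKey i (keyOf v)
  keyOf-swap i v = trans (cong toKey (bits-swap (punchIn 3F i) v)) (toKey-swapBits i (bits e v))

  module Symmetrised (φ : Key → ℤ) (π : List (List (Fin 5))) (πs : List (List (List (Fin 4)))) where
    open Symmetrise π πs

    -- Connects the sum over orderings of actual vertices with the table lookups that `averageOk`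
    -- evaluates: outer walks act on patterns, inner walks on keys.
    symmetrise-bits : ∀ v → symmetrise (φ ∘ keyOf) v ≡ orbitSum swapBits π (recall (stages πs (memo φ)) ∘ toKey) (bits e v)
    symmetrise-bits = orbitSum-map (bits e) bits-swap π λ v →
      trans (innerSum-map keyOf keyOf-swap πs (λ _ → refl) v)
      (trans (sym (innerSum-cong swapKey πs (recall-memo φ) (keyOf v)))
             (sym (recall-stages πs (memo φ) (keyOf v))))

  <ᵇ-sound : ∀ m n → (m <ᵇ n) ≡ true → m ℕ.< n
  <ᵇ-sound m n eq = ℕP.<ᵇ⇒< m n (Equivalence.from T-≡ eq)

  nonNegative-sound : ∀ z → nonNegative z ≡ true → 0ℤ ≤ z
  nonNegative-sound (+ _) _ = +≤+ ℕ.z≤n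

  module _ (φ : Key → ℤ) (ws π : List (List (Fin 5))) (πs : List (List (List (Fin 4)))) (t : Trie ℤ 16)
           (tabulated : ∀ v → Symmetrise.symmetrise π πs (φ ∘ keyOf) v ≡ orbitSum swapBits π (recall t ∘ toKey) (bits e v))
           (checked : Certificate ws π t) (closed : Invariance.Closed π πs)
           (I₄-free : ¬ InducedCopy I34 G) (M₂-free : ¬ InducedCopy M2 G) where

    open Symmetrise π πs

    -- Induction on `code`. A descending swap yields a smaller code, the same sum by invariance, and
    -- a tuple that is still injective; every other outcome gives the sign or a forbidden copy.
    symmetrise-nonneg : ∀ v → Acc ℕ._<_ (code (bits e v)) → collisions v ≡ 0 → 0ℤ ≤ symmetrise (φ ∘ keyOf) v
    byOutcome : ∀ v → Acc ℕ._<_ (code (bits e v)) → collisions v ≡ 0 → Outcome ws π t (bits e v) → 0ℤ ≤ symmetrise (φ ∘ keyOf) v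
    symmetrise-nonneg v a free = byOutcome v a free (outcome ws π t checked (bits e v))
    byOutcome v _ free (heavy g)   = subst (0ℤ ≤_) (sym (tabulated v)) (nonNegative-sound (orbitSum swapBits π (recall t ∘ toKey) (bits e v)) g)
    byOutcome v _ free (empty h)   = contradiction (copy-I₄ v free h) I₄-free
    byOutcome v _ free (I₄-copy h) = contradiction (find-I₄ π v free h) I₄-free
    byOutcome v _ free (M₂-copy h) = contradiction (find-M₂ ws v free h) M₂-free
    byOutcome v (acc rec) free (descent i d) =
      subst (0ℤ ≤_) (Invariance.symmetrise-swapAt π πs closed (φ ∘ keyOf) i v)
        (symmetrise-nonneg (swapAt i v) (rec smaller) (trans (collisions-swapAt i v) free))
      where
      smaller : code (bits e (swapAt i v)) ℕ.< code (bits e v)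
      smaller = subst (λ p → code p ℕ.< code (bits e v)) (sym (bits-swap i v))
        (<ᵇ-sound (code (swapBits i (bits e v))) (code (bits e v)) d)

-- Positivity of sums of inner products

head₀ : List ℤ → ℤ
head₀ []      = 0ℤ
head₀ (x ∷ _) = x

tail₀ : List ℤ → List ℤ
tail₀ []       = []
tail₀ (_ ∷ xs) = xs

dot-[]ʳ : ∀ m xs → dot m xs [] ≡ 0ℤ
dot-[]ʳ zero    xs       = refl
dot-[]ʳ (suc m) []       = refl
dot-[]ʳ (suc m) (x ∷ xs) = refl

dot-[]ˡ : ∀ m ys → dot m [] ys ≡ 0ℤ
dot-[]ˡ zero    ys = refl
dot-[]ˡ (suc m) ys = refl

dot-suc : ∀ m xs ys → dot (suc m) xs ys ≡ head₀ xs * head₀ ys + dot m (tail₀ xs) (tail₀ ys)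
dot-suc m []       ys       = sym (trans (cong₂ _+_ (ℤP.*-zeroˡ (head₀ ys)) (dot-[]ˡ m (tail₀ ys))) refl)
dot-suc m (x ∷ xs) []       = sym (trans (cong₂ _+_ (ℤP.*-zeroʳ x) (dot-[]ʳ m xs)) refl)
dot-suc m (x ∷ xs) (y ∷ ys) = refl

square-nonneg : ∀ z → 0ℤ ≤ z * z
square-nonneg (+ zero)     = +≤+ ℕ.z≤n
square-nonneg (+ suc n)    = +≤+ ℕ.z≤n
square-nonneg -[1+ n ]     = +≤+ ℕ.z≤n

∑ⱽ-square : ∀ k (h : Vec (Fin n) k → ℤ) → ∑ⱽ k (λ v → ∑ⱽ k λ w → h v * h w) ≡ ∑ⱽ k h * ∑ⱽ k h
∑ⱽ-square k h = begin
  ∑ⱽ k (λ v → ∑ⱽ k λ w → h v * h w)  ≡⟨ ∑ⱽ-cong k (λ v → trans (∑ⱽ-* k (h v) h) (ℤP.*-comm (h v) (∑ⱽ k h))) ⟩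
  ∑ⱽ k (λ v → ∑ⱽ k h * h v)          ≡⟨ ∑ⱽ-* k (∑ⱽ k h) h ⟩
  ∑ⱽ k h * ∑ⱽ k h                    ∎
  where open ≡-Reasoning

-- Each coordinate contributes the square of its total over all tuples; the induction splits off one
-- coordinate at a time.
gram-nonneg : ∀ m k (f : Vec (Fin n) k → List ℤ) → 0ℤ ≤ ∑ⱽ k λ v → ∑ⱽ k λ w → dot m (f v) (f w)
gram-nonneg {n} zero k f = ≤-reflexive (sym (begin
  ∑ⱽ k (λ v → ∑ⱽ k λ w → 0ℤ)  ≡⟨ ∑ⱽ-cong k (λ v → trans (∑ⱽ-const n k 0ℤ) (ℤP.*-zeroʳ ((+ n) ^ k))) ⟩
  ∑ⱽ {n} k (λ v → 0ℤ)         ≡⟨ trans (∑ⱽ-const n k 0ℤ) (ℤP.*-zeroʳ ((+ n) ^ k)) ⟩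
  0ℤ                          ∎))
  where open ≡-Reasoning
gram-nonneg (suc m) k f = subst (0ℤ ≤_) (sym split)
  (ℤP.+-mono-≤ {0ℤ} {_} {0ℤ} (square-nonneg (∑ⱽ k (head₀ ∘ f))) (gram-nonneg m k (tail₀ ∘ f)))
  where
  open ≡-Reasoning
  D : _ → _ → ℤ
  D v w = dot m (tail₀ (f v)) (tail₀ (f w))
  split : ∑ⱽ k (λ v → ∑ⱽ k λ w → dot (suc m) (f v) (f w)) ≡ ∑ⱽ k (head₀ ∘ f) * ∑ⱽ k (head₀ ∘ f) + ∑ⱽ k (λ v → ∑ⱽ k (D v))
  split = begin
    ∑ⱽ k (λ v → ∑ⱽ k λ w → dot (suc m) (f v) (f w))
      ≡⟨ ∑ⱽ-cong k (λ v → trans (∑ⱽ-cong k (λ w → dot-suc m (f v) (f w))) (∑ⱽ-+ k (λ w → head₀ (f v) * head₀ (f w)) (D v))) ⟩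
    ∑ⱽ k (λ v → ∑ⱽ k (λ w → head₀ (f v) * head₀ (f w)) + ∑ⱽ k (D v))
      ≡⟨ ∑ⱽ-+ k (λ v → ∑ⱽ k (λ w → head₀ (f v) * head₀ (f w))) (λ v → ∑ⱽ k (D v)) ⟩
    ∑ⱽ k (λ v → ∑ⱽ k (λ w → head₀ (f v) * head₀ (f w))) + ∑ⱽ k (λ v → ∑ⱽ k (D v))
      ≡⟨ cong₂ _+_ (∑ⱽ-square k (head₀ ∘ f)) refl ⟩
    ∑ⱽ k (head₀ ∘ f) * ∑ⱽ k (head₀ ∘ f) + ∑ⱽ k (λ v → ∑ⱽ k (D v)) ∎

sum-nonneg : {f : Fin n → ℤ} → (∀ i → 0ℤ ≤ f i) → 0ℤ ≤ sum f
sum-nonneg {n} {f} f≥0 = subst (_≤ sum f) (sum-zero n) (sum-mono f≥0)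

-- Edges counted over ordered triples

sumℕ-allFin : ∀ (f : Fin n → ℕ) → + sumℕ (map f (allFin n)) ≡ sum (λ i → + f i)
sumℕ-allFin {n} f = trans (cong (+_ ∘ sumℕ) (map-tabulate id f)) (go f)
  where
  go : ∀ {n} (f : Fin n → ℕ) → + sumℕ (List.tabulate f) ≡ sum (λ i → + f i)
  go {zero}  f = refl
  go {suc n} f = cong₂ _+_ (refl {x = + f zero}) (go (f ∘ suc))

module Counting (G : 3Graph n) where

  e : Fin n → Fin n → Fin n → Bool
  e = edge G

  ∑³ : (Fin n → Fin n → Fin n → ℤ) → ℤ
  ∑³ f = sum λ a → sum λ b → sum λ c → f a b c

  increasing : Fin n → Fin n → Fin n → ℕ
  increasing a b c = b2n (⌊ a <? b ⌋ ∧ ⌊ b <? c ⌋ ∧ e a b c)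

  numEdges-∑ : ∑³ (λ a b c → + increasing a b c) ≡ + numEdges G
  numEdges-∑ = sym (trans (sumℕ-allFin {n} _) (sum-cong-≗ {n} λ a →
               trans (sumℕ-allFin {n} _) (sum-cong-≗ {n} λ b → sumℕ-allFin {n} (increasing a b))))

  ∑³-swap₁ : ∀ f → ∑³ (λ a b c → f b a c) ≡ ∑³ f
  ∑³-swap₁ f = ∑-comm (λ a b → sum λ c → f b a c)

  ∑³-swap₂ : ∀ f → ∑³ (λ a b c → f a c b) ≡ ∑³ f
  ∑³-swap₂ f = sum-cong-≗ λ a → ∑-comm (λ b c → f a c b)

  ∑³-+ : ∀ f g → ∑³ (λ a b c → f a b c + g a b c) ≡ ∑³ f + ∑³ g
  ∑³-+ f g = trans (sum-cong-≗ {n} λ a → trans (sum-cong-≗ λ b → ∑-distrib-+ (f a b) (g a b))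
                                           (∑-distrib-+ (λ b → sum (f a b)) (λ b → sum (g a b))))
                   (∑-distrib-+ (λ a → sum λ b → sum (f a b)) (λ a → sum λ b → sum (g a b)))

  ∑³-δ : ∑³ (λ a b c → + δ a b) ≡ + n * + n
  ∑³-δ = begin
    (sum {n} λ a → sum {n} λ b → sum {n} λ c → + δ a b)   ≡⟨ ∑-comm {n} {n} (λ a b → sum {n} λ c → + δ a b) ⟩
    (sum {n} λ b → sum {n} λ a → sum {n} λ c → + δ a b)   ≡⟨ sum-cong-≗ {n} inner ⟩
    (sum {n} λ b → + n)                                   ≡⟨ sum-const n (+ n) ⟩
    + n * + n                                             ∎
    where
    open ≡-Reasoning
    inner : ∀ b → (sum {n} λ a → sum {n} λ c → + δ a b) ≡ + n
    inner b = begin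
      (sum {n} λ a → sum {n} λ c → + δ a b)  ≡⟨ sum-cong-≗ {n} (λ a → sum-const n (+ δ a b)) ⟩
      (sum {n} λ a → + n * + δ a b)          ≡⟨ *-distribˡ-sum {n} (+ n) (λ a → + δ a b) ⟨
      + n * (sum {n} λ a → + δ a b)          ≡⟨ cong (λ z → + n * z) (∑δ b) ⟩
      + n * + 1                              ≡⟨ ℤP.*-identityʳ (+ n) ⟩
      + n                                    ∎

  -- The six orderings of a triple, and the three ways in which it can degenerate.
  orders : Fin n → Fin n → Fin n → List ℕ
  orders a b c = i a b c ∷ i a c b ∷ i b a c ∷ i b c a ∷ i c a b ∷ i c b a ∷ δ a b ∷ δ a c ∷ δ b c ∷ []
    where i = increasing

  increasing-≡ : ∀ {a b c} → a Fin.< b → b Fin.< c → b2n (e a b c) ≡ increasing a b c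
  increasing-≡ {a} {b} {c} a<b b<c with a <? b | b <? c
  ... | yes _  | yes _  = refl
  ... | yes _  | no b≮c = contradiction b<c b≮c
  ... | no a≮b | _      = contradiction a<b a≮b

  b2n≤1 : ∀ x → b2n x ℕ.≤ 1
  b2n≤1 true  = ℕP.≤-refl
  b2n≤1 false = ℕ.z≤n

  lookup≤sum : ∀ xs (k : Fin (List.length xs)) → List.lookup xs k ℕ.≤ sumℕ xs
  lookup≤sum (x ∷ xs) zero    = ℕP.m≤m+n x (sumℕ xs)
  lookup≤sum (x ∷ xs) (suc k) = ℕP.≤-trans (lookup≤sum xs k) (ℕP.m≤n+m (sumℕ xs) x)

  b2n≤δ : ∀ x (a : Fin n) → b2n x ℕ.≤ δ a a
  b2n≤δ x a = subst (b2n x ℕ.≤_) (sym (δ-refl a)) (b2n≤1 x)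

  -- `edge` may be true on triples with repeated entries, which the `δ` terms absorb. Three distinct
  -- entries have an increasing ordering, and its term equals the edge bit by symmetry.
  edge≤orders : ∀ a b c → b2n (e a b c) ℕ.≤ sumℕ (orders a b c)
  edge≤orders a b c with FinP.<-cmp a b | FinP.<-cmp b c | FinP.<-cmp a c
  ... | tri≈ _ refl _ | _ | _ = ℕP.≤-trans (b2n≤δ (e a a c) a) (lookup≤sum (orders a a c) (# 6))
  ... | _ | tri≈ _ refl _ | _ = ℕP.≤-trans (b2n≤δ (e a b b) b) (lookup≤sum (orders a b b) (# 8))
  ... | _ | _ | tri≈ _ refl _ = ℕP.≤-trans (b2n≤δ (e a b a) a) (lookup≤sum (orders a b a) (# 7))
  ... | tri< a<b _ _ | tri< b<c _ _ | _            = ℕP.≤-trans (ℕP.≤-reflexive (increasing-≡ a<b b<c)) (lookup≤sum (orders a b c) (# 0))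
  ... | tri< a<b _ _ | tri> _ _ c<b | tri< a<c _ _ = ℕP.≤-trans (ℕP.≤-reflexive (trans (cong b2n (sym₂ G a b c)) (increasing-≡ a<c c<b))) (lookup≤sum (orders a b c) (# 1))
  ... | tri< a<b _ _ | tri> _ _ c<b | tri> _ _ c<a = ℕP.≤-trans (ℕP.≤-reflexive (trans (cong b2n (trans (sym₂ G a b c) (sym₁ G a c b))) (increasing-≡ c<a a<b))) (lookup≤sum (orders a b c) (# 4))
  ... | tri> _ _ b<a | tri< b<c _ _ | tri< a<c _ _ = ℕP.≤-trans (ℕP.≤-reflexive (trans (cong b2n (sym₁ G a b c)) (increasing-≡ b<a a<c))) (lookup≤sum (orders a b c) (# 2))
  ... | tri> _ _ b<a | tri< b<c _ _ | tri> _ _ c<a = ℕP.≤-trans (ℕP.≤-reflexive (trans (cong b2n (trans (sym₁ G a b c) (sym₂ G b a c))) (increasing-≡ b<c c<a))) (lookup≤sum (orders a b c) (# 3))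
  ... | tri> _ _ b<a | tri> _ _ c<b | _            = ℕP.≤-trans (ℕP.≤-reflexive (trans (cong b2n (trans (sym₁ G a b c) (trans (sym₂ G b a c) (sym₁ G b c a)))) (increasing-≡ c<b b<a))) (lookup≤sum (orders a b c) (# 5))

  ∑³-orders : ∑³ (λ a b c → + sumℕ (orders a b c)) ≡ + 6 * + numEdges G + + 3 * (+ n * + n)
  ∑³-orders = begin
    ∑³ (λ a b c → + sumℕ (orders a b c))
      ≡⟨ plus (λ a b c → + i a b c) refl (plus (λ a b c → + i a c b) (∑³-swap₂ I) (plus (λ a b c → + i b a c) (∑³-swap₁ I)
        (plus (λ a b c → + i b c a) (bca I) (plus (λ a b c → + i c a b) (cab I) (plus (λ a b c → + i c b a) (trans (∑³-swap₁ (λ x y z → I z x y)) (cab I))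
        (plus (λ a b c → + δ a b) ∑³-δ (plus (λ a b c → + δ a c) (trans (∑³-swap₂ Δ) ∑³-δ) (plus (λ a b c → + δ b c) (trans (∑³-swap₁ (λ x y z → + δ x z)) (trans (∑³-swap₂ Δ) ∑³-δ)) ∑³-0)))))))) ⟩
    E + (E + (E + (E + (E + (E + (+ n * + n + (+ n * + n + (+ n * + n + 0ℤ))))))))
      ≡⟨ collect E (+ n * + n) ⟩
    + 6 * E + + 3 * (+ n * + n)
      ≡⟨ cong (λ z → + 6 * z + + 3 * (+ n * + n)) numEdges-∑ ⟩
    + 6 * + numEdges G + + 3 * (+ n * + n) ∎
    where
    open ≡-Reasoning
    i = increasing
    I Δ : Fin n → Fin n → Fin n → ℤ
    I a b c = + increasing a b c
    Δ a b c = + δ a b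
    E = ∑³ I
    collect : ∀ x y → x + (x + (x + (x + (x + (x + (y + (y + (y + + 0)))))))) ≡ + 6 * x + + 3 * y
    collect = solve-∀
    plus : ∀ f {g x y} → ∑³ f ≡ x → ∑³ g ≡ y → ∑³ (λ a b c → f a b c + g a b c) ≡ x + y
    plus f {g} p q = trans (∑³-+ f g) (cong₂ _+_ p q)
    ∑³-0 : ∑³ (λ a b c → 0ℤ) ≡ 0ℤ
    ∑³-0 = trans (sum-cong-≗ {n} λ a → trans (sum-cong-≗ {n} λ b → sum-zero n) (sum-zero n)) (sum-zero n)
    bca : ∀ f → ∑³ (λ a b c → f b c a) ≡ ∑³ f
    bca f = trans (∑³-swap₁ (λ x y z → f x z y)) (∑³-swap₂ f)
    cab : ∀ f → ∑³ (λ a b c → f c a b) ≡ ∑³ f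
    cab f = trans (∑³-swap₂ (λ x y z → f y x z)) (∑³-swap₁ f)

  ∑edge≤ : ∑³ (λ a b c → + b2n (e a b c)) ≤ + 6 * + numEdges G + + 3 * (+ n * + n)
  ∑edge≤ = subst (∑³ (λ a b c → + b2n (e a b c)) ≤_) ∑³-orders
    (sum-mono {n} λ a → sum-mono {n} λ b → sum-mono {n} λ c → +≤+ (edge≤orders a b c))

-- Bounds for the total weight

pos-^ : ∀ n k → (+ n) ^ k ≡ + (n ℕ.^ k)
pos-^ n zero    = refl
pos-^ n (suc k) = trans (cong (λ z → + n * z) (pos-^ n k)) (sym (ℤP.pos-* n (n ℕ.^ k)))

-- Existence is enough, since `B` enters only the size required of n.
lowerBound : ∀ k (f : Vec Bool k → ℤ) → ∃[ B ] ∀ v → - (+ B) ≤ f v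
lowerBound zero f = ℤ.∣ f [] ∣ , λ { [] → below (f []) }
  where
  below : ∀ z → - (+ ℤ.∣ z ∣) ≤ z
  below (+ zero)  = ≤-refl
  below (+ suc n) = -≤+
  below -[1+ n ]  = ≤-refl
lowerBound (suc k) f with lowerBound k (f ∘ (false ∷_)) | lowerBound k (f ∘ (true ∷_))
... | B , hB | B′ , hB′ = B ℕ.⊔ B′ , λ
  { (false ∷ v) → ≤-trans (ℤP.neg-mono-≤ (+≤+ (ℕP.m≤m⊔n B B′))) (hB v)
  ; (true ∷ v)  → ≤-trans (ℤP.neg-mono-≤ (+≤+ (ℕP.m≤n⊔m B B′))) (hB′ v) }

toPattern-flatten : ∀ p → toPattern (flatten p) ≡ p
toPattern-flatten (pattern₆ _ _ _ _ _ _ _ _ _ _ _ _ _ _ _ _ _ _ _ _) = refl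

size : List (List (List (Fin 4))) → ℕ
size []       = 1
size (π ∷ πs) = size πs ℕ.* length π

∑ⱽ-innerSum : ∀ {n} πs (f : Vec (Fin n) 6 → ℤ) → ∑ⱽ 6 (innerSum swapInner πs f) ≡ + size πs * ∑ⱽ 6 f
∑ⱽ-innerSum []       f = sym (ℤP.*-identityˡ (∑ⱽ 6 f))
∑ⱽ-innerSum (π ∷ πs) f = begin
  ∑ⱽ 6 (innerSum swapInner πs (orbitSum swapInner π f))  ≡⟨ ∑ⱽ-innerSum πs (orbitSum swapInner π f) ⟩
  + size πs * ∑ⱽ 6 (orbitSum swapInner π f)              ≡⟨ cong (λ z → + size πs * z) (∑ⱽ-orbitSum swapInner (λ i g → ∑ⱽ-swapAt (punchIn 3F i) g) π f) ⟩
  + size πs * (+ length π * ∑ⱽ 6 f)                      ≡⟨ ℤP.*-assoc (+ size πs) (+ length π) (∑ⱽ 6 f) ⟨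
  + size πs * + length π * ∑ⱽ 6 f                        ≡⟨ cong (λ z → z * ∑ⱽ 6 f) (ℤP.pos-* (size πs) (length π)) ⟨
  + size (π ∷ πs) * ∑ⱽ 6 f                               ∎
  where open ≡-Reasoning

∑ⱽ-symmetrise : ∀ {n} π πs (f : Vec (Fin n) 6 → ℤ) →
                ∑ⱽ 6 (Symmetrise.symmetrise π πs f) ≡ + (length π ℕ.* size πs) * ∑ⱽ 6 f
∑ⱽ-symmetrise π πs f = begin
  ∑ⱽ 6 (orbitSum swapAt π (innerSum swapInner πs f))  ≡⟨ ∑ⱽ-orbitSum swapAt (λ i g → ∑ⱽ-swapAt i g) π (innerSum swapInner πs f) ⟩
  + length π * ∑ⱽ 6 (innerSum swapInner πs f)         ≡⟨ cong (λ z → + length π * z) (∑ⱽ-innerSum πs f) ⟩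
  + length π * (+ size πs * ∑ⱽ 6 f)                   ≡⟨ ℤP.*-assoc (+ length π) (+ size πs) (∑ⱽ 6 f) ⟨
  + length π * + size πs * ∑ⱽ 6 f                     ≡⟨ cong (λ z → z * ∑ⱽ 6 f) (ℤP.pos-* (length π) (size πs)) ⟨
  + (length π ℕ.* size πs) * ∑ⱽ 6 f                   ∎
  where open ≡-Reasoning

-- K and L stand for 10⁸ and 0.4557 · 10⁸: with literals, conversion checking would unfold their products in unary.
module Density {n : ℕ} (G : 3Graph n) (T : Tables) (K L : ℕ)
               (constant : ∀ β → (if β then + 54430000 else -[1+ 45569999 ]) ≡ + K * + b2n β + - (+ L)) where

  open Counting G using (e; ∑³; ∑edge≤)
  open Copies G using (keyOf)

  φ : Vec (Fin n) 6 → ℤ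
  φ = weight T ∘ keyOf

  row : Fin n → Fin n → Fin n → Fin n → Fin n → List ℤ
  row a b c d x = gram₄ T (e a b c ∷ e a b d ∷ e a c d ∷ e b c d ∷ [])
                          (e a b x ∷ e a c x ∷ e a d x ∷ e b c x ∷ e b d x ∷ e c d x ∷ [])

  row₀ : Fin n → Fin n → Fin n → Fin n → List ℤ
  row₀ a b c d = lookupT (Tables.t₀ T) (e a b c ∷ e a b d ∷ e a c d ∷ e b c d ∷ [])

  excess square₄ square₀ : Vec (Fin n) 6 → ℤ
  excess  (a ∷ b ∷ c ∷ _)              = + K * + b2n (e a b c) + - (+ L)
  square₄ (a ∷ b ∷ c ∷ d ∷ x ∷ y ∷ []) = dot 14 (row a b c d x) (row a b c d y)
  square₀ (a ∷ b ∷ c ∷ d ∷ x ∷ y ∷ []) = dot 3 (row₀ a b c x) (row₀ a b d y)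

  φ-split : ∀ v → φ v + (square₄ v + square₀ v) ≡ excess v
  φ-split (a ∷ b ∷ c ∷ d ∷ x ∷ y ∷ []) = trans
    (cancel (if e a b c then + 54430000 else -[1+ 45569999 ]) (dot 14 (row a b c d x) (row a b c d y)) (dot 3 (row₀ a b c x) (row₀ a b d y)))
    (constant (e a b c))
    where
    cancel : ∀ r s t → r - s - t + (s + t) ≡ r
    cancel = solve-∀

  square₄-nonneg : 0ℤ ≤ ∑ⱽ 6 square₄
  square₄-nonneg = sum-nonneg {n} λ a → sum-nonneg {n} λ b → sum-nonneg {n} λ c → sum-nonneg {n} λ d →
    gram-nonneg 14 1 (λ v → row a b c d (Vec.head v))

  square₀-nonneg : 0ℤ ≤ ∑ⱽ 6 square₀
  -- The pairs cx and dy are interleaved in the tuple; exchanging the fourth and fifth places makes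
  -- each pair contiguous, as `gram-nonneg` requires.
  square₀-nonneg = subst (0ℤ ≤_) (∑ⱽ-swapAt 3F square₀)
    (sum-nonneg {n} λ a → sum-nonneg {n} λ b → gram-nonneg 3 2 (λ v → row₀ a b (Vec.head v) (Vec.head (Vec.tail v))))

  ∑φ≤∑excess : ∑ⱽ 6 φ ≤ ∑ⱽ 6 excess
  ∑φ≤∑excess = begin
    ∑ⱽ 6 φ                                        ≡⟨ ℤP.+-identityʳ (∑ⱽ 6 φ) ⟨
    ∑ⱽ 6 φ + 0ℤ                                   ≤⟨ ℤP.+-monoʳ-≤ (∑ⱽ 6 φ) (ℤP.+-mono-≤ {0ℤ} {_} {0ℤ} square₄-nonneg square₀-nonneg) ⟩
    ∑ⱽ 6 φ + (∑ⱽ 6 square₄ + ∑ⱽ 6 square₀)        ≡⟨ cong₂ _+_ (refl {x = ∑ⱽ 6 φ}) (∑ⱽ-+ 6 square₄ square₀) ⟨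
    ∑ⱽ 6 φ + ∑ⱽ 6 (λ v → square₄ v + square₀ v)   ≡⟨ ∑ⱽ-+ 6 φ (λ v → square₄ v + square₀ v) ⟨
    ∑ⱽ 6 (λ v → φ v + (square₄ v + square₀ v))    ≡⟨ ∑ⱽ-cong 6 φ-split ⟩
    ∑ⱽ 6 excess                                   ∎
    where open ℤP.≤-Reasoning

  cube : ℤ
  cube = (+ n) ^ 3

  -- The excess reads only the first three vertices, so the free last three contribute the factor
  -- `cube`.
  ∑excess : ∑ⱽ 6 excess ≡ cube * (+ K * ∑³ (λ a b c → + b2n (e a b c)) + - (+ L) * cube)
  ∑excess = begin
    (sum {n} λ a → sum {n} λ b → sum {n} λ c → ∑ⱽ {n} 3 (λ _ → ex a b c))
      ≡⟨ (sum-cong-≗ {n} λ a → trans (sum-cong-≗ {n} λ b → trans (sum-cong-≗ {n} λ c → ∑ⱽ-const n 3 (ex a b c))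
           (sym (*-distribˡ-sum {n} cube (ex a b)))) (sym (*-distribˡ-sum {n} cube (λ b → sum (ex a b))))) ⟩
    (sum {n} λ a → cube * (sum {n} λ b → sum {n} (ex a b)))
      ≡⟨ *-distribˡ-sum {n} cube (λ a → sum {n} λ b → sum {n} (ex a b)) ⟨
    cube * ∑ⱽ 3 (λ v → + K * E v + - (+ L))
      ≡⟨ cong (λ z → cube * z) (trans (∑ⱽ-+ 3 (λ v → + K * E v) (λ _ → - (+ L)))
           (cong₂ _+_ (∑ⱽ-* 3 (+ K) E) (trans (∑ⱽ-const n 3 (- (+ L))) (ℤP.*-comm cube (- (+ L)))))) ⟩
    cube * (+ K * ∑³ (λ a b c → + b2n (e a b c)) + - (+ L) * cube) ∎
    where
    open ≡-Reasoning
    ex : Fin n → Fin n → Fin n → ℤ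
    ex a b c = + K * + b2n (e a b c) + - (+ L)
    E : Vec (Fin n) 3 → ℤ
    E (a ∷ b ∷ c ∷ []) = + b2n (e a b c)

  ∑φ≤ : ∑ⱽ 6 φ ≤ cube * (+ K * (+ 6 * + numEdges G + + 3 * (+ n * + n)) + - (+ L) * cube)
  ∑φ≤ = begin
    ∑ⱽ 6 φ      ≤⟨ ∑φ≤∑excess ⟩
    ∑ⱽ 6 excess ≡⟨ ∑excess ⟩
    cube * (+ K * ∑³ (λ a b c → + b2n (e a b c)) + - (+ L) * cube)
      ≤⟨ ℤP.*-monoˡ-≤-nonNeg cube {{cube-nonneg}} (ℤP.+-monoˡ-≤ (- (+ L) * cube) (ℤP.*-monoˡ-≤-nonNeg (+ K) ∑edge≤)) ⟩
    cube * (+ K * (+ 6 * + numEdges G + + 3 * (+ n * + n)) + - (+ L) * cube) ∎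
    where
    open ℤP.≤-Reasoning
    cube-nonneg : ℤ.NonNegative cube
    cube-nonneg = ℤ.nonNegative (subst (0ℤ ≤_) (trans (∑ⱽ-const n 3 (+ 1)) (ℤP.*-identityʳ cube)) (sum-nonneg {n} λ _ → sum-nonneg {n} λ _ → sum-nonneg {n} λ _ → +≤+ ℕ.z≤n))

  module _ (π : List (List (Fin 5))) (πs : List (List (List (Fin 4)))) (B : ℕ)
           (bounded : ∀ v → - (+ B) ≤ Symmetrise.symmetrise π πs φ v)
           (nonneg : ∀ v → collisions v ≡ 0 → 0ℤ ≤ Symmetrise.symmetrise π πs φ v)
           (nonempty : 1 ℕ.≤ length π ℕ.* size πs) where

    open Symmetrise π πs

    -- A tuple that is not injective has at least one collision, so scaling its bound by the number
    -- of collisions only weakens it.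
    symmetrise≥ : ∀ v → - (+ B) * + collisions v ≤ symmetrise φ v
    symmetrise≥ v with collisions v in eq
    ... | zero  = ≤-trans (≤-reflexive (ℤP.*-zeroʳ (- (+ B)))) (nonneg v eq)
    ... | suc k = ≤-trans (subst (_≤ - (+ B)) (ℤP.neg-distribˡ-* (+ B) (+ suc k))
                    (ℤP.neg-mono-≤ (subst (+ B ≤_) (ℤP.pos-* B (suc k)) (+≤+ (ℕP.m≤m*n B (suc k)))))) (bounded v)

    N : ℕ
    N = length π ℕ.* size πs

    -- 15 is `pairs 6`, the number of pairs of places that can coincide.
    N∑φ≥ : - (+ (15 ℕ.* B)) * (+ n) ^ 5 ≤ + N * ∑ⱽ 6 φ
    N∑φ≥ = begin
      - (+ (15 ℕ.* B)) * (+ n) ^ 5                ≡⟨ cong (λ z → - z * (+ n) ^ 5) (ℤP.pos-* 15 B) ⟩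
      - (+ 15 * + B) * (+ n) ^ 5                  ≡⟨ shuffle (+ B) ((+ n) ^ 5) ⟩
      - (+ B) * (+ 15 * (+ n) ^ 5)                ≡⟨ cong (λ z → - (+ B) * z) (∑collisions n 5) ⟨
      - (+ B) * ∑ⱽ {n} 6 (λ v → + collisions v)   ≡⟨ ∑ⱽ-* {n} 6 (- (+ B)) (λ v → + collisions v) ⟨
      ∑ⱽ {n} 6 (λ v → - (+ B) * + collisions v)   ≤⟨ ∑ⱽ-mono {n} 6 symmetrise≥ ⟩
      ∑ⱽ 6 (symmetrise φ)                         ≡⟨ ∑ⱽ-symmetrise π πs φ ⟩
      + N * ∑ⱽ 6 φ                                ∎
      where
      open ℤP.≤-Reasoning
      shuffle : ∀ b x → - (+ 15 * b) * x ≡ - b * (+ 15 * x)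
      shuffle = solve-∀

    -- A negative total does not increase when multiplied by `N` ≥ 1, and a nonnegative one
    -- satisfies the bound at once.
    ∑φ≥ : - (+ (15 ℕ.* B)) * (+ n) ^ 5 ≤ ∑ⱽ 6 φ
    ∑φ≥ = shrink (∑ⱽ 6 φ) N∑φ≥
      where
      D = 15 ℕ.* B
      pow≡ : - (+ D) * (+ n) ^ 5 ≡ - (+ (D ℕ.* n ℕ.^ 5))
      pow≡ = trans (cong (λ z → - (+ D) * z) (pos-^ n 5)) (trans (sym (ℤP.neg-distribˡ-* (+ D) (+ (n ℕ.^ 5)))) (cong -_ (sym (ℤP.pos-* D (n ℕ.^ 5)))))
      shrink : ∀ z → - (+ D) * (+ n) ^ 5 ≤ + N * z → - (+ D) * (+ n) ^ 5 ≤ z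
      shrink (+ z)    _ = ≤-trans (≤-reflexive pow≡) (≤-trans (ℤP.neg-mono-≤ (+≤+ ℕ.z≤n)) (+≤+ ℕ.z≤n))
      shrink -[1+ z ] h = ≤-trans h (≤-trans (ℤP.*-monoʳ-≤-nonPos -[1+ z ] (+≤+ nonempty)) (≤-reflexive (ℤP.*-identityˡ -[1+ z ])))

    -- The lower bound has order n⁵ and the upper bound carries the factor n³. Dividing by n³ leaves
    -- an error of order n² against the main term of order n³.
    edgeBound : 1 ℕ.≤ n → L ℕ.* n ℕ.^ 3 ℕ.≤ K ℕ.* (6 ℕ.* numEdges G ℕ.+ 3 ℕ.* (n ℕ.* n)) ℕ.+ 15 ℕ.* B ℕ.* n ℕ.^ 2
    edgeBound 1≤n = ℤP.drop‿+≤+ (subst (λ z → + (L ℕ.* n ℕ.^ 3) ≤ z) (sym casts) (begin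
      + (L ℕ.* n ℕ.^ 3)           ≡⟨ trans (ℤP.pos-* L (n ℕ.^ 3)) (cong (λ z → + L * z) (sym (pos-^ n 3))) ⟩
      + L * cube                  ≡⟨ ℤP.+-identityʳ (+ L * cube) ⟨
      + L * cube + 0ℤ             ≤⟨ ℤP.+-monoʳ-≤ (+ L * cube) (ℤP.*-cancelˡ-≤-pos 0ℤ (X + D * sq + - (+ L) * cube) cube {{cube-pos}} (≤-trans (≤-reflexive (ℤP.*-zeroʳ cube)) scaled)) ⟩
      + L * cube + (X + D * sq + - (+ L) * cube)  ≡⟨ restore (+ L) cube (X + D * sq) ⟩
      X + D * sq                  ∎))
      where
      open ℤP.≤-Reasoning
      D sq X : ℤ
      D = + (15 ℕ.* B)
      sq = (+ n) ^ 2
      X = + K * (+ 6 * + numEdges G + + 3 * (+ n * + n))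
      restore : ∀ l c y → l * c + (y + - l * c) ≡ y
      restore = solve-∀
      expand : ∀ m d x l → m * (m * (m * + 1)) * (x + - l * (m * (m * (m * + 1)))) + d * (m * (m * (m * (m * (m * + 1)))))
                         ≡ m * (m * (m * + 1)) * (x + d * (m * (m * + 1)) + - l * (m * (m * (m * + 1))))
      expand = solve-∀
      undo : ∀ d p → - d * p + d * p ≡ 0ℤ
      undo = solve-∀
      scaled : 0ℤ ≤ cube * (X + D * sq + - (+ L) * cube)
      scaled = subst₂ _≤_ (undo D ((+ n) ^ 5)) (expand (+ n) D X (+ L))
        (ℤP.+-monoˡ-≤ (D * (+ n) ^ 5) (≤-trans ∑φ≥ ∑φ≤))
      cube-pos : ℤ.Positive cube
      cube-pos = subst ℤ.Positive (sym (pos-^ n 3)) (ℤ.positive (ℤ.+<+ (ℕP.m^n>0 n {{ℕ.>-nonZero 1≤n}} 3)))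
      casts : + (K ℕ.* (6 ℕ.* numEdges G ℕ.+ 3 ℕ.* (n ℕ.* n)) ℕ.+ 15 ℕ.* B ℕ.* n ℕ.^ 2) ≡ X + D * sq
      casts = cong₂ _+_
        (trans (ℤP.pos-* K (6 ℕ.* numEdges G ℕ.+ 3 ℕ.* (n ℕ.* n)))
               (cong (λ z → + K * z) (cong₂ _+_ (ℤP.pos-* 6 (numEdges G)) (trans (ℤP.pos-* 3 (n ℕ.* n)) (cong (λ z → + 3 * z) (ℤP.pos-* n n))))))
        (trans (ℤP.pos-* (15 ℕ.* B) (n ℕ.^ 2)) (cong (λ z → D * z) (sym (pos-^ n 2))))

-- Binomial coefficients and the passage to densities

2*C₂ : ∀ n → 2 ℕ.* (n C 2) ℕ.+ n ≡ n ℕ.* n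
2*C₂ zero    = refl
2*C₂ (suc n) = begin
  2 ℕ.* (suc n C 2) ℕ.+ suc n           ≡⟨ cong (λ z → 2 ℕ.* z ℕ.+ suc n) (nCk+nC[k+1]≡[n+1]C[k+1] n 1) ⟨
  2 ℕ.* (n C 1 ℕ.+ n C 2) ℕ.+ suc n       ≡⟨ cong (λ z → 2 ℕ.* (z ℕ.+ n C 2) ℕ.+ suc n) (nC1≡n n) ⟩
  2 ℕ.* (n ℕ.+ n C 2) ℕ.+ suc n           ≡⟨ regroup n (n C 2) ⟩
  (2 ℕ.* (n C 2) ℕ.+ n) ℕ.+ (2 ℕ.* n ℕ.+ 1)   ≡⟨ cong (ℕ._+ (2 ℕ.* n ℕ.+ 1)) (2*C₂ n) ⟩
  n ℕ.* n ℕ.+ (2 ℕ.* n ℕ.+ 1)               ≡⟨ expand n ⟩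
  suc n ℕ.* suc n                     ∎
  where
  open ≡-Reasoning
  regroup : ∀ n c → 2 ℕ.* (n ℕ.+ c) ℕ.+ suc n ≡ (2 ℕ.* c ℕ.+ n) ℕ.+ (2 ℕ.* n ℕ.+ 1)
  regroup = ℕ-Solver.solve-∀
  expand : ∀ n → n ℕ.* n ℕ.+ (2 ℕ.* n ℕ.+ 1) ≡ suc n ℕ.* suc n
  expand = ℕ-Solver.solve-∀

-- This is n(n - 1)(n - 2) = n³ - 3n² + 2n with the negative term moved across.
6*C₃ : ∀ n → 6 ℕ.* (n C 3) ℕ.+ 3 ℕ.* (n ℕ.* n) ≡ n ℕ.^ 3 ℕ.+ 2 ℕ.* n
6*C₃ zero    = refl
6*C₃ (suc n) = begin
  6 ℕ.* (suc n C 3) ℕ.+ 3 ℕ.* (suc n ℕ.* suc n)                         ≡⟨ cong (λ z → 6 ℕ.* z ℕ.+ 3 ℕ.* (suc n ℕ.* suc n)) (nCk+nC[k+1]≡[n+1]C[k+1] n 2) ⟨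
  6 ℕ.* (n C 2 ℕ.+ n C 3) ℕ.+ 3 ℕ.* (suc n ℕ.* suc n)                     ≡⟨ regroup n (n C 2) (n C 3) ⟩
  (6 ℕ.* (n C 3) ℕ.+ 3 ℕ.* (n ℕ.* n)) ℕ.+ 3 ℕ.* (2 ℕ.* (n C 2) ℕ.+ n) ℕ.+ (3 ℕ.* n ℕ.+ 3)  ≡⟨ cong₂ (λ x y → x ℕ.+ 3 ℕ.* y ℕ.+ (3 ℕ.* n ℕ.+ 3)) (6*C₃ n) (2*C₂ n) ⟩
  (n ℕ.^ 3 ℕ.+ 2 ℕ.* n) ℕ.+ 3 ℕ.* (n ℕ.* n) ℕ.+ (3 ℕ.* n ℕ.+ 3)                   ≡⟨ expand n ⟩
  suc n ℕ.^ 3 ℕ.+ 2 ℕ.* suc n                                         ∎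
  where
  open ≡-Reasoning
  regroup : ∀ n c d → 6 ℕ.* (c ℕ.+ d) ℕ.+ 3 ℕ.* (suc n ℕ.* suc n) ≡ (6 ℕ.* d ℕ.+ 3 ℕ.* (n ℕ.* n)) ℕ.+ 3 ℕ.* (2 ℕ.* c ℕ.+ n) ℕ.+ (3 ℕ.* n ℕ.+ 3)
  regroup = ℕ-Solver.solve-∀
  expand : ∀ n → (n ℕ.* (n ℕ.* (n ℕ.* 1)) ℕ.+ 2 ℕ.* n) ℕ.+ 3 ℕ.* (n ℕ.* n) ℕ.+ (3 ℕ.* n ℕ.+ 3) ≡ suc n ℕ.* (suc n ℕ.* (suc n ℕ.* 1)) ℕ.+ 2 ℕ.* suc n
  expand = ℕ-Solver.solve-∀

6*C₃≤ : ∀ n → 6 ℕ.* (n C 3) ℕ.≤ n ℕ.^ 3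
6*C₃≤ zero      = ℕ.z≤n
6*C₃≤ n@(suc m) = ℕP.+-cancelʳ-≤ (3 ℕ.* (n ℕ.* n)) _ _ (begin
  6 ℕ.* (n C 3) ℕ.+ 3 ℕ.* (n ℕ.* n)  ≡⟨ 6*C₃ n ⟩
  n ℕ.^ 3 ℕ.+ 2 ℕ.* n              ≤⟨ ℕP.+-monoʳ-≤ (n ℕ.^ 3) (ℕP.*-mono-≤ {2} {3} (ℕ.s≤s (ℕ.s≤s ℕ.z≤n)) (ℕP.m≤m*n n n)) ⟩
  n ℕ.^ 3 ℕ.+ 3 ℕ.* (n ℕ.* n)        ∎)
  where open ℕP.≤-Reasoning

-- Makes quadratic errors negligible. The 3 in the threshold pays for the 3n² by which six times the
-- binomial may fall short of n³.
C₃-large : ∀ q n → 6 ℕ.* q ℕ.+ 3 ℕ.≤ n → q ℕ.* n ℕ.^ 2 ℕ.≤ n C 3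
C₃-large q n 6q+3≤n = ℕP.*-cancelˡ-≤ 6 (ℕP.+-cancelʳ-≤ (3 ℕ.* (n ℕ.* n)) _ _ (begin
  6 ℕ.* (q ℕ.* n ℕ.^ 2) ℕ.+ 3 ℕ.* (n ℕ.* n)  ≡⟨ factor q n ⟩
  (6 ℕ.* q ℕ.+ 3) ℕ.* (n ℕ.* n)          ≤⟨ ℕP.*-monoˡ-≤ (n ℕ.* n) 6q+3≤n ⟩
  n ℕ.* (n ℕ.* n)                    ≡⟨ power n ⟩
  n ℕ.^ 3                          ≤⟨ ℕP.m≤m+n (n ℕ.^ 3) (2 ℕ.* n) ⟩
  n ℕ.^ 3 ℕ.+ 2 ℕ.* n                  ≡⟨ 6*C₃ n ⟨
  6 ℕ.* (n C 3) ℕ.+ 3 ℕ.* (n ℕ.* n)      ∎))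
  where
  open ℕP.≤-Reasoning
  factor : ∀ q n → 6 ℕ.* (q ℕ.* (n ℕ.* (n ℕ.* 1))) ℕ.+ 3 ℕ.* (n ℕ.* n) ≡ (6 ℕ.* q ℕ.+ 3) ℕ.* (n ℕ.* n)
  factor = ℕ-Solver.solve-∀
  power : ∀ n → n ℕ.* (n ℕ.* n) ≡ n ℕ.* (n ℕ.* (n ℕ.* 1))
  power = ℕ-Solver.solve-∀

module _ (K L a b : ℕ) .{{_ : ℕ.NonZero K}} (ratio : b ℕ.* L ≡ a ℕ.* K) where

  -- With ε = p/q this is (a/b - ε) C(n,3) ≤ E cleared of denominators. The quadratic error 3K + D
  -- collects degenerate triples and non-injective tuples.
  density : ∀ {n E D q p} → L ℕ.* n ℕ.^ 3 ℕ.≤ K ℕ.* (6 ℕ.* E ℕ.+ 3 ℕ.* (n ℕ.* n)) ℕ.+ D ℕ.* n ℕ.^ 2 → 1 ℕ.≤ p →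
            6 ℕ.* (q ℕ.* (3 ℕ.* K ℕ.+ D)) ℕ.+ 3 ℕ.≤ n → a ℕ.* q ℕ.* (n C 3) ℕ.≤ b ℕ.* (E ℕ.* q) ℕ.+ p ℕ.* b ℕ.* (n C 3)
  density {n} {E} {D} {q} {p} bound 1≤p large = ℕP.*-cancelˡ-≤ (6 ℕ.* K) {{ℕP.m*n≢0 6 K}} (begin
    6 ℕ.* K ℕ.* (a ℕ.* q ℕ.* c)                   ≡⟨ lhs K a q c ⟩
    q ℕ.* ((a ℕ.* K) ℕ.* (6 ℕ.* c))               ≡⟨ cong (λ z → q ℕ.* (z ℕ.* (6 ℕ.* c))) ratio ⟨
    q ℕ.* ((b ℕ.* L) ℕ.* (6 ℕ.* c))               ≤⟨ ℕP.*-monoʳ-≤ q (ℕP.*-monoʳ-≤ (b ℕ.* L) (6*C₃≤ n)) ⟩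
    q ℕ.* ((b ℕ.* L) ℕ.* n ℕ.^ 3)                 ≡⟨ assoc q b L (n ℕ.^ 3) ⟩
    q ℕ.* b ℕ.* (L ℕ.* n ℕ.^ 3)                   ≤⟨ ℕP.*-monoʳ-≤ (q ℕ.* b) bound ⟩
    q ℕ.* b ℕ.* (K ℕ.* (6 ℕ.* E ℕ.+ 3 ℕ.* (n ℕ.* n)) ℕ.+ D ℕ.* n ℕ.^ 2)  ≡⟨ rhs q b K E n D ⟩
    6 ℕ.* K ℕ.* (b ℕ.* (E ℕ.* q)) ℕ.+ b ℕ.* (q ℕ.* (3 ℕ.* K ℕ.+ D) ℕ.* n ℕ.^ 2)  ≤⟨ ℕP.+-monoʳ-≤ (6 ℕ.* K ℕ.* (b ℕ.* (E ℕ.* q))) (ℕP.*-monoʳ-≤ b (C₃-large (q ℕ.* (3 ℕ.* K ℕ.+ D)) n large)) ⟩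
    -- The term with ε offers `6 ℕ.* K ℕ.* p` copies of `b ℕ.* c`, and the error needs only one.
    6 ℕ.* K ℕ.* (b ℕ.* (E ℕ.* q)) ℕ.+ b ℕ.* c         ≤⟨ ℕP.+-monoʳ-≤ (6 ℕ.* K ℕ.* (b ℕ.* (E ℕ.* q))) (subst₂ ℕ._≤_ (ℕP.*-identityˡ (b ℕ.* c)) (sym (ℕP.*-assoc (6 ℕ.* K ℕ.* p) b c)) (ℕP.*-monoˡ-≤ (b ℕ.* c) 1≤6Kp)) ⟩
    6 ℕ.* K ℕ.* (b ℕ.* (E ℕ.* q)) ℕ.+ 6 ℕ.* K ℕ.* p ℕ.* b ℕ.* c  ≡⟨ collect K (b ℕ.* (E ℕ.* q)) p b c ⟩
    6 ℕ.* K ℕ.* (b ℕ.* (E ℕ.* q) ℕ.+ p ℕ.* b ℕ.* c)     ∎)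
    where
    open ℕP.≤-Reasoning
    c = n C 3
    1≤6Kp : 1 ℕ.≤ 6 ℕ.* K ℕ.* p
    1≤6Kp = ℕP.*-mono-≤ {1} {6 ℕ.* K} (ℕ.>-nonZero⁻¹ (6 ℕ.* K) {{ℕP.m*n≢0 6 K}}) 1≤p
    lhs : ∀ K a q c → 6 ℕ.* K ℕ.* (a ℕ.* q ℕ.* c) ≡ q ℕ.* ((a ℕ.* K) ℕ.* (6 ℕ.* c))
    lhs = ℕ-Solver.solve-∀
    assoc : ∀ q b L x → q ℕ.* ((b ℕ.* L) ℕ.* x) ≡ q ℕ.* b ℕ.* (L ℕ.* x)
    assoc = ℕ-Solver.solve-∀
    rhs : ∀ q b K E n D → q ℕ.* b ℕ.* (K ℕ.* (6 ℕ.* E ℕ.+ 3 ℕ.* (n ℕ.* n)) ℕ.+ D ℕ.* (n ℕ.* (n ℕ.* 1))) ≡ 6 ℕ.* K ℕ.* (b ℕ.* (E ℕ.* q)) ℕ.+ b ℕ.* (q ℕ.* (3 ℕ.* K ℕ.+ D) ℕ.* (n ℕ.* (n ℕ.* 1)))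
    rhs = ℕ-Solver.solve-∀
    collect : ∀ K x p b c → 6 ℕ.* K ℕ.* x ℕ.+ 6 ℕ.* K ℕ.* p ℕ.* b ℕ.* c ≡ 6 ℕ.* K ℕ.* (x ℕ.+ p ℕ.* b ℕ.* c)
    collect = ℕ-Solver.solve-∀

-- Unnormalised rationals keep numerators and denominators explicit, so the claim becomes the given
-- integer inequality by cross-multiplication.
fraction≤ : ∀ a b p q .(c : Coprime (suc p) (suc q)) N E → a ℕ.* suc q ℕ.* N ℕ.≤ suc b ℕ.* (E ℕ.* suc q) ℕ.+ suc p ℕ.* suc b ℕ.* N →
            (+ a / suc b ℚ.- mkℚ (+ suc p) q c) ℚ.* ℕtoℚ N ℚ.≤ ℕtoℚ E
fraction≤ a b p q c N E bound = ℚP.toℚᵘ-cancel-≤ (ℚᵘP.≤-respˡ-≃ (ℚᵘP.≃-sym lhs≃) (ℚᵘP.≤-respʳ-≃ (ℚᵘP.≃-sym (ℚP.toℚᵘ-fromℚᵘ (mkℚᵘ (+ E) 0))) (*≤* crossed)))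
  where
  ε = mkℚ (+ suc p) q c
  lhs≃ : toℚᵘ ((+ a / suc b ℚ.- ε) ℚ.* ℕtoℚ N) ℚᵘ.≃ (mkℚᵘ (+ a) b ℚᵘ.- mkℚᵘ (+ suc p) q) ℚᵘ.* mkℚᵘ (+ N) 0
  lhs≃ = ℚᵘP.≃-trans (ℚP.toℚᵘ-homo-* (+ a / suc b ℚ.- ε) (ℕtoℚ N))
    (ℚᵘP.*-cong (ℚᵘP.≃-trans (ℚP.toℚᵘ-homo-+ (+ a / suc b) (ℚ.- ε))
                             (ℚᵘP.+-cong (ℚP.toℚᵘ-fromℚᵘ (mkℚᵘ (+ a) b)) (ℚP.toℚᵘ-homo‿- ε)))
                (ℚP.toℚᵘ-fromℚᵘ (mkℚᵘ (+ N) 0)))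
  Q R B : ℤ
  Q = + suc q
  R = + suc p
  B = + suc b
  expand : ∀ a q p b c → (a ℤ.* q ℤ.+ ℤ.- p ℤ.* b) ℤ.* c ℤ.* + 1 ≡ a ℤ.* q ℤ.* c ℤ.+ ℤ.- (p ℤ.* b ℤ.* c)
  expand = solve-∀
  contract : ∀ b e q p c → b ℤ.* (e ℤ.* q) ℤ.+ p ℤ.* b ℤ.* c ℤ.+ ℤ.- (p ℤ.* b ℤ.* c) ≡ e ℤ.* (b ℤ.* q ℤ.* + 1)
  contract = solve-∀
  pos₃ : ∀ x y z → + (x ℕ.* y ℕ.* z) ≡ + x ℤ.* + y ℤ.* + z
  pos₃ x y z = trans (ℤP.pos-* (x ℕ.* y) z) (cong (λ t → t ℤ.* + z) (ℤP.pos-* x y))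
  crossed : (+ a ℤ.* Q ℤ.+ ℤ.- R ℤ.* B) ℤ.* + N ℤ.* + 1 ℤ.≤ + E ℤ.* + (suc b ℕ.* suc q ℕ.* 1)
  crossed = begin
    (+ a ℤ.* Q ℤ.+ ℤ.- R ℤ.* B) ℤ.* + N ℤ.* + 1       ≡⟨ expand (+ a) Q R B (+ N) ⟩
    + a ℤ.* Q ℤ.* + N ℤ.+ ℤ.- (R ℤ.* B ℤ.* + N)        ≡⟨ cong (λ z → z ℤ.+ ℤ.- (R ℤ.* B ℤ.* + N)) (pos₃ a (suc q) N) ⟨
    + (a ℕ.* suc q ℕ.* N) ℤ.+ ℤ.- (R ℤ.* B ℤ.* + N)    ≤⟨ ℤP.+-monoˡ-≤ (ℤ.- (R ℤ.* B ℤ.* + N)) (ℤ.+≤+ bound) ⟩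
    + (suc b ℕ.* (E ℕ.* suc q)) ℤ.+ + (suc p ℕ.* suc b ℕ.* N) ℤ.+ ℤ.- (R ℤ.* B ℤ.* + N)
      ≡⟨ cong₂ (λ y z → y ℤ.+ z ℤ.+ ℤ.- (R ℤ.* B ℤ.* + N)) (trans (ℤP.pos-* (suc b) (E ℕ.* suc q)) (cong (λ z → B ℤ.* z) (ℤP.pos-* E (suc q)))) (pos₃ (suc p) (suc b) N) ⟩
    B ℤ.* (+ E ℤ.* Q) ℤ.+ R ℤ.* B ℤ.* + N ℤ.+ ℤ.- (R ℤ.* B ℤ.* + N)  ≡⟨ contract B (+ E) Q R (+ N) ⟩
    + E ℤ.* (B ℤ.* Q ℤ.* + 1)                          ≡⟨ cong (λ z → + E ℤ.* z) (pos₃ (suc b) (suc q) 1) ⟨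
    + E ℤ.* + (suc b ℕ.* suc q ℕ.* 1)                  ∎
    where open ℤP.≤-Reasoning

-- From a checked certificate to the density bound

module Main (K L a b : ℕ) .{{_ : ℕ.NonZero K}} (ratio : suc b ℕ.* L ≡ a ℕ.* K)
            (T : Tables) (constant : ∀ β → (if β then + 54430000 else -[1+ 45569999 ]) ≡ + K ℤ.* + b2n β ℤ.+ ℤ.- (+ L))
            (ws π : List (List (Fin 5))) (πs : List (List (List (Fin 4)))) (t : Trie ℤ 16)
            (tabulated : ∀ {n} (G : 3Graph n) v → Symmetrise.symmetrise π πs (weight T ∘ Copies.keyOf G) v
                                                ≡ orbitSum swapBits π (recall t ∘ toKey) (bits (edge G) v))
            (checked : Certificate ws π t) (closed : Invariance.Closed π πs) (nonempty : 1 ℕ.≤ length π ℕ.* size πs) where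

  total : Pattern → ℤ
  total = orbitSum swapBits π (recall t ∘ toKey)

  conclude : ∀ B → (∀ v → ℤ.- (+ B) ℤ.≤ total (toPattern v)) → πmin≥ ((4 , I34) ∷ (6 , M2) ∷ []) (+ a / suc b)
  conclude B below (mkℚ (+ zero)  q c) (*<* (ℤ.+<+ ()))
  conclude B below (mkℚ -[1+ p ]  q c) (*<* ())
  conclude B below (mkℚ (+ suc p) q c) _ = N , λ n N≤n G free →
    fraction≤ a b p q c (n C 3) (numEdges G)
      (density K L a (suc b) ratio {n} {numEdges G} {15 ℕ.* B} {suc q} {suc p}
        (Density.edgeBound G T K L constant π πs B (bounded G) (nonneg G free) nonempty (ℕP.≤-trans (ℕP.≤-trans (ℕ.s≤s ℕ.z≤n) (ℕP.m≤n+m 3 M)) N≤n))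
        (ℕ.s≤s ℕ.z≤n) N≤n)
    where
    -- The threshold of `density` for D = 15B; the 3 added to it also guarantees n ≥ 1.
    M = 6 ℕ.* (suc q ℕ.* (3 ℕ.* K ℕ.+ 15 ℕ.* B))
    N = M ℕ.+ 3
    bounded : ∀ {n} (G : 3Graph n) v → ℤ.- (+ B) ℤ.≤ Symmetrise.symmetrise π πs (weight T ∘ Copies.keyOf G) v
    bounded G v = subst (ℤ.- (+ B) ℤ.≤_) (sym (tabulated G v))
      (subst (λ p → ℤ.- (+ B) ℤ.≤ total p) (toPattern-flatten (bits (edge G) v)) (below (flatten (bits (edge G) v))))
    nonneg : ∀ {n} (G : 3Graph n) → Free ((4 , I34) ∷ (6 , M2) ∷ []) G → ∀ v → collisions v ≡ 0 →
             ℤ.0ℤ ℤ.≤ Symmetrise.symmetrise π πs (weight T ∘ Copies.keyOf G) v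
    nonneg G (I₄-free ∷ M₂-free ∷ []) v = Copies.symmetrise-nonneg G (weight T) ws π πs t (tabulated G) checked closed I₄-free M₂-free v
      (<-wellFounded (code (bits (edge G) v)))

  result : πmin≥ ((4 , I34) ∷ (6 , M2) ∷ []) (+ a / suc b)
  result = conclude (proj₁ bound) (proj₂ bound)
    where
    bound : ∃[ B ] ∀ v → ℤ.- (+ B) ℤ.≤ total (toPattern v)
    bound = lowerBound 20 (total ∘ toPattern)

-- The certificate and its evaluation

-- The entries are in units of 10⁻⁴; a row is 0 where the bits force an I₄.
rows₁ : List ℕ
rows₁ =
  0 ∷ 0 ∷ 0 ∷ 1973888700339589233 ∷ 0 ∷ 0 ∷ 0 ∷ 99096067189378607749 ∷ 0 ∷ 1973888700339589233 ∷
  96054222590339589233 ∷ 9838995122 ∷ 1576998750290696160 ∷ 1079990109501499596 ∷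
  1828078479501499596 ∷ 3028030059915487869 ∷ 0 ∷ 0 ∷ 1576998750290696160 ∷ 1079990109501499596 ∷
  0 ∷ 0 ∷ 1535124759690709892 ∷ 2533039499829796176 ∷ 0 ∷ 99096067189378607749 ∷
  1828078479501499596 ∷ 3028030059915487869 ∷ 1535124759690709892 ∷ 2533039499829796176 ∷
  6227863669426604641 ∷ 16435036760624495198 ∷ 0 ∷ 96848002510290696160 ∷ 0 ∷
  97093931439501499596 ∷ 0 ∷ 1920788989690709892 ∷ 0 ∷ 96818863759829796176 ∷ 0 ∷
  97093931439501499596 ∷ 1808865659378607749 ∷ 93944939919915487869 ∷ 96545086279690709892 ∷
  96886068179426604641 ∷ 649096759829796176 ∷ 91783981620624495198 ∷ 0 ∷ 1920788989690709892 ∷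
  96545086279690709892 ∷ 96886068179426604641 ∷ 9784108130 ∷ 4173789369659210015 ∷
  97914105329659210015 ∷ 94325896001381317065 ∷ 0 ∷ 96818863759829796176 ∷ 649096759829796176 ∷
  91783981620624495198 ∷ 97914105329659210015 ∷ 94325896001381317065 ∷ 11350208001381317065 ∷
  518993064 ∷ []

rows₂ : List ℕ
rows₂ =
  0 ∷ 999149769198893984488717370923 ∷ 0 ∷
  137600526927361265299703954260471987308998250061592620968600713698081 ∷ 0 ∷
  9862499474072648734899703954269528112692998250061592620968600713698081 ∷ 0 ∷
  66010190000000000997600850998580907469313714211 ∷ 0 ∷
  9862499474072648734800297045740471987308998250061592620968600713698081 ∷
  7083563002850227104543950397816798090 ∷ 9630274920002599714107888014249881692767 ∷
  9821397633032978534800000000000000000000006189718905209042308761610521 ∷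
  87012986930768055600000000000000000000047640566098700118900624087369 ∷
  9975898853974409888000061009300188688547005129636599627071629997419265 ∷
  8098923954150206599175883649445092277007030006401907882799879006168 ∷ 0 ∷
  137600526927361265200297045749528112692998250061592620968600713698081 ∷
  178702367967031465200000000000000000000006189718905209042308761610521 ∷
  9913087014069241944400000000000000000000047640566098700118900624087369 ∷
  9993016437002850227104543950397816798090 ∷ 369825080002599714107888014249881692767 ∷
  24201147025600112000061009309811411453005129636599627071629997419265 ∷
  9992001077045859793599175883640555007723007030006401907882799879006168 ∷ 0 ∷
  99934989810000000000997600850998580907469313714211 ∷
  24201147025600112099939990700188688547005129636599627071629997419265 ∷
  9992001077045859793500825116369445092277007030006401907882799879006168 ∷
  9975898853974409888099939990709811411453005129636599627071629997419265 ∷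
  8098923954150206500825116360555007723007030006401907882799879006168 ∷
  3159922004256053940299521642 ∷ 22329734599107731699110125931 ∷ 0 ∷
  998169930496229004000673995101 ∷ 0 ∷
  49102998076450155200159024490645884489995430308005019955750658587537 ∷ 0 ∷
  9950997002923559844800159024499354215511995430308005019955750658587537 ∷ 0 ∷
  276042580000000000999860009497223968632043508795 ∷ 0 ∷
  9950997002923559844899841975510645884489995430308005019955750658587537 ∷
  9995188469997520457494199946040434209863 ∷ 9186586137998279955107201019391067395874 ∷
  9863897708007958925500000000000000000000995040560207008009681109814112 ∷
  9795495866985928475400000000000000000000003059908604242948020828201124 ∷
  9910896063915999560399248883979043501035997769990502187071160359005379 ∷
  503896374008088981090779026569728782765006699481802370873030923792877 ∷ 0 ∷
  49102998076450155299841975519354215511995430308005019955750658587537 ∷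
  136202292992051074500000000000000000000995040560207008009681109814112 ∷
  204604134014081524600000000000000000000003059908604242948020828201124 ∷
  4911531997520457494199946040434209863 ∷ 813513863998279955107201019391067395874 ∷
  89203937084010439799248883970956598965997769990502187071160359005379 ∷
  9496203626991921019090779026560271317235006699481802370873030923792877 ∷ 0 ∷
  99724957420000000000999860009497223968632043508795 ∷
  89203937084010439700752116039043501035997769990502187071160359005379 ∷
  9496203626991921019009221973449728782765006699481802370873030923792877 ∷
  9910896063915999560300752116030956598965997769990502187071160359005379 ∷
  503896374008088981009221973440271317235006699481802370873030923792877 ∷
  1469911807981059801255118281 ∷ 4689359387508034750126801764 ∷ []

rows₃ : List ℕ
rows₃ =
  0 ∷ 0 ∷ 0 ∷ 0 ∷ 9050367697596961719247000000006619995496676 ∷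
  1589787104664819768208199999001859961892612 ∷ 999830668398449163209016000001001859961892612 ∷
  3879694396645914439694900000904380191305885 ∷ 0 ∷ 0 ∷ 0 ∷ 0 ∷
  998281239499523988208956300000013049413717885 ∷ 992350138602043911098527200000982289855901195 ∷
  28960098396960109168992900000982289855901195 ∷ 988569773904804001059310800000988340412005041 ∷
  9050367697596961719247000000006619995496676 ∷ 1589787104664819768208100001001859961892612 ∷
  998281239499523988208956300000013049413717885 ∷ 992350138602043911098527200000982289855901195 ∷
  11181720593938836247849300000015879769486225 ∷ 900864799648788286982600000009739901699663 ∷
  4310485599533219478063900006025320229312911 ∷ 992078439094301042787574997229011819910007924 ∷
  999830668398449163209016099999001859961892612 ∷ 3879694396645914439694900000904380191305885 ∷
  28960098396960109168992900000982289855901195 ∷ 988569773904804001059310800000988340412005041 ∷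
  4310485599533219478063999994025320229312911 ∷ 992078439094301042787574902771011819910007924 ∷
  995480149406365103518037500000031429995902550 ∷ 997799052307523072758369100000011610438908583 ∷
  981909264704807076581506000000006619995496676 ∷ 3447521200954023592087300000013049413717885 ∷
  998599544596887017042775899999001859961892612 ∷ 978699763100997979752479900000982289855901195 ∷
  994419139703031081881075300000015879769486225 ∷ 985350092798838809121472099994025320229312911 ∷
  999559567600176105861508700000009739901699663 ∷ 36829588105080786952254802771011819910007924 ∷
  998599544596887017042775800001001859961892612 ∷ 978699763100997979752479900000982289855901195 ∷
  992260611406709171140610200000904380191305885 ∷ 22880452290391997901378400000988340412005041 ∷
  10349421801629971410464100006025320229312911 ∷ 2269925396817948250981200000031429995902550 ∷
  971111973000618170260170397229011819910007924 ∷ 1100473996238963630815400000011610438908583 ∷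
  994419139703031081881075300000015879769486225 ∷ 985350092798838809121472000006025320229312911 ∷
  10349421801629971410464199994025320229312911 ∷ 2269925396817948250981200000031429995902550 ∷
  986509463402363 ∷ 977629813392332735520381500000113119755104789 ∷
  11190093303834132249809200000113119755104789 ∷ 8749732101585909910138400000123220339093010 ∷
  999559567600176105861508700000009739901699663 ∷ 36829588105080786952254897229011819910007924 ∷
  971111973000618170260170302771011819910007924 ∷ 1100473996238963630815400000011610438908583 ∷
  11190093303834132249809200000113119755104789 ∷ 8749732101585909910138400000123220339093010 ∷
  982520535996829180199723300000123220339093010 ∷ 6689754105586 ∷ []

rows₄ : List ℕ
rows₄ =
  95310968489865902804 ∷ 9988799994007420024497307931690000001035961170422201494 ∷
  5700003996290024497307931690000001035961170422201494 ∷
  9960399977026060272301811887870000097295980199580597793 ∷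
  5700003996299975602693068310000001035961170422201494 ∷
  9960399977026069921500184046650000097295980199580597793 ∷
  79300045947899921500184046650000097295980199580597793 ∷ 15299738986320000000647990640264897818 ∷
  5700003996290024497307931690000001035961170422201494 ∷
  9960399977026060272301811887870000097295980199580597793 ∷
  79300045947890272301811887870000097295980199580597793 ∷ 229501264900180000099937989609526603943 ∷
  33800019977830000000000000000000000543062779647407199 ∷
  980319919502519979689767703372900940360297384046130414699724 ∷
  19690261398632049059767703372900949639897384046130414699724 ∷
  20200012986749907094071929880000000474071589846199015 ∷
  5700003996299975602693068310000001035961170422201494 ∷
  9960399977026069921500184046650000097295980199580597793 ∷
  33800019977830000000000000000000000543062779647407199 ∷
  19699919502519979689767703372900949639897384046130414699724 ∷
  79300045947899884697821018830000097295980199580597793 ∷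
  9923599579033270000099937989609526603943 ∷
  19690261398632049050232396628099060360297384046130414699724 ∷
  20200012986740045301229000330000000474071589846199015 ∷
  79300045947899921500184046650000097295980199580597793 ∷ 15299738986320000000647990640264897818 ∷
  980310261398632049059767703372900940360297384046130414699724 ∷
  20200012986749907094071929880000000474071589846199015 ∷
  980310261398632049050232396628099069639897384046130414699724 ∷
  20200012986740045301229000330000000474071589846199015 ∷
  219600125857080000000000000000000000572989030189194717 ∷
  45900026969850021698255952590000002620020189791095940 ∷
  9988799994007429975602693068310000001035961170422201494 ∷
  9932499962044340000000000000000000000543062779647407199 ∷
  9960399977026069921500184046650000097295980199580597793 ∷
  980319819298848971279767703372900940360297384046130414699724 ∷
  9960399977026069884697821018830000097295980199580597793 ∷
  980319819298848971270232396628099069639897384046130414699724 ∷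
  9923599579033270000099937989609526603943 ∷
  9959699977026510045301229000330000000474071589846199015 ∷
  9960399977026069921500184046650000097295980199580597793 ∷
  19699819298848971279767703372900949639897384046130414699724 ∷
  15299738986320000000647990640264897818 ∷
  9959699977026519907094071929880000000474071589846199015 ∷
  19699919502519979680232396628099060360297384046130414699724 ∷
  9890299937071460000000000000000000000572989030189194717 ∷
  20200012986740045301229000330000000474071589846199015 ∷
  9977099987015070021698255952590000002620020189791095940 ∷
  9960399977026069884697821018830000097295980199580597793 ∷
  19699819298848971270232396628099060360297384046130414699724 ∷
  980319919502519979680232396628099069639897384046130414699724 ∷
  9890299937071460000000000000000000000572989030189194717 ∷
  9954300786041030000000647990640264897818 ∷
  9959699977026510002403471069460000000474071589846199015 ∷
  20200012986740002403471069460000000474071589846199015 ∷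
  9977099987015079978401745047410000002620020189791095940 ∷
  9923599579033270000099937989609526603943 ∷
  9959699977026510045301229000330000000474071589846199015 ∷
  20200012986740045301229000330000000474071589846199015 ∷
  9977099987015070021698255952590000002620020189791095940 ∷
  20200012986740002403471069460000000474071589846199015 ∷
  9977099987015079978401745047410000002620020189791095940 ∷
  45900026969859978401745047410000002620020189791095940 ∷ 2250040979764598782 ∷ []

rows₀ : List ℕ
rows₀ =
  0 ∷ 957919994401284 ∷ 42099994401284 ∷ 183998947 ∷ 9932398289 ∷ 964280052296737 ∷
  35720052296737 ∷ 180401772 ∷ 9932398289 ∷ 964280052296737 ∷ 35720052296737 ∷ 180401772 ∷
  9851496788 ∷ 979119878105994 ∷ 20899878105994 ∷ 37505040 ∷ []

certificateTables : Tables
certificateTables = tables (unpack 4 3 rows₀) (unpack 6 4 rows₁) (unpack 6 14 rows₂) (unpack 6 9 rows₃) (unpack 6 12 rows₄)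

checked : Certificate M₂-words outerPath (stages innerPaths (memo (weight certificateTables)))
checked = refl

closed : Invariance.Closed outerPath innerPaths
closed 0F = refl
closed 1F = refl
closed 2F = refl
closed 3F = refl
closed 4F = refl

theorem4p2 : πmin≥ ((4 , I34) ∷ (6 , M2) ∷ []) (+ 4557 / 10000)
-- 9999 is the predecessor of the denominator; the first `refl` is 10000 · 45570000 = 4557 · 10⁸.
theorem4p2 = Main.result 100000000 45570000 4557 9999 refl certificateTables (λ { true → refl ; false → refl })
  M₂-words outerPath innerPaths (stages innerPaths (memo (weight certificateTables)))
  (λ G → Copies.Symmetrised.symmetrise-bits G (weight certificateTables) outerPath innerPaths)
  checked closed (ℕ.s≤s ℕ.z≤n)
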